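{- Let $X$ be a finite graph with edge set $E(X)$, let $|E(X)|$ be the number of its edges, and let $\deg(X)$ be its degree. Let $F_1(X)$ be its first spectral density function. Then for all real $\lambda$ with $0 \le \lambda < 1$, $$F_1(X)(\lambda) - F_1(X)(0) \le 2 \cdot |E(X)| \cdot \deg(X) \cdot \lambda .$$
   Context: A finite graph $X$ has a finite vertex set $V(X)$ and a finite edge set $E(X)$; loops and multiple edges are allowed (equivalently, $X$ is a finite one-dimensional CW complex). Each edge $e$ is given an orientation, with initial vertex $v_0(e)$ and terminal vertex $v_1(e)$; the quantities below do not depend on the choice of orientations. The degree $d_v$ of a vertex $v$ is the number of edges having precisely one endpoint equal to $v$ plus twice the number of edges both of whose endpoints equal $v$. The degree of $X$ is $\deg(X) = \max\{d_v \mid v \in V(X)\}$. Let $C_1(X) = l^2(E(X))$ and $C_0(X) = l^2(V(X))$ be the real vector spaces of sequences of real numbers indexed by $E(X)$ and $V(X)$, with the standard Euclidean inner products. Define the linear map $$c_1 \colon C_1(X) \to C_0(X), \quad (a_e)_{e \in E(X)} \mapsto \Big( \sum_{e :\, v_1(e) = v} a_e - \sum_{e :\, v_0(e) = v} a_e \Big)_{v \in V(X)} .$$ For a linear map $f \colon V \to W$ of finite-dimensional Hilbert spaces, its spectral density function $F(f) \colon [0,\infty) \to [0,\infty)$ sends $\lambda$ to the supremum of the dimensions of all linear subspaces $V_0 \subseteq V$ such that $|f(v)| \le \lambda \cdot |v|$ for all $v \in V_0$. (Thus $F(f)(\lambda) - F(f)(0)$ is the number of non-zero singular values of $f$, counted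 with multiplicity, that are $\le \lambda$.) The first spectral density function of $X$ is $F_1(X) := F(c_1 \colon C_1(X) \to C_0(X))$. -}

module Defs where

open import Algebra.Bundles.Raw using (RawMonoid)
import Algebra.Definitions.RawMonoid as RawMonoidDefs
open import Data.Bool.Base using (if_then_else_)
open import Data.Fin.Base using (Fin)
open import Data.Fin.Properties as Fin using ()
open import Data.Integer.Base as ℤ using (+_)
import Data.Integer.Properties as ℤ
open import Data.List.Base using (allFin; filter; length)
open import Data.Nat.Base as ℕ using (ℕ; zero; suc)
import Data.Nat.DivMod as ℕ
import Data.Nat.Properties as ℕ
open import Data.Product.Base using (Σ; ∃; _×_; _,_; proj₁; proj₂)
open import Data.Rational.Base as ℚ using (ℚ; 0ℚ; 1ℚ; ½; ∣_∣; ↥_; ↧ₙ_)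
import Data.Rational.Properties as ℚ
open import Data.Rational.Solver using (module +-*-Solver)
import Data.Rational.Unnormalised.Base as ℚᵘ
import Data.Rational.Unnormalised.Properties as ℚᵘ
open import Data.Sum.Base using (_⊎_; inj₁; inj₂)
open import Data.Vec.Functional using (Vector; foldr)
open import Data.Vec.Functional.Relation.Binary.Pointwise using (Pointwise)
open import Level using (0ℓ)
open import Relation.Binary.PropositionalEquality
  using (_≡_; _≢_; refl; sym; trans; cong; subst; subst₂)
open import Relation.Nullary using (¬_; does; yes; no; contradiction; ¬?; _×-dec_; _⊎-dec_)
open import Relation.Unary using (Pred; Decidable)

∣-∣≤ : ∀ {p q ε} → p ℚ.≤ q ℚ.+ ε → q ℚ.≤ p ℚ.+ ε → ∣ p ℚ.- q ∣ ℚ.≤ ε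
∣-∣≤ {p} {q} {ε} p≤ q≤ with ℚ.∣p∣≡p∨∣p∣≡-p (p ℚ.- q)
... | inj₁ eq = ℚ.≤-trans (ℚ.≤-reflexive eq)
      (subst (p ℚ.- q ℚ.≤_) (lem q ε) (ℚ.+-monoˡ-≤ (ℚ.- q) p≤))
  where lem : ∀ q ε → q ℚ.+ ε ℚ.- q ≡ ε
        lem = solve 2 (λ q ε → q :+ ε :- q := ε) refl
          where open +-*-Solver
... | inj₂ eq = ℚ.≤-trans (ℚ.≤-reflexive eq)
      (subst₂ ℚ._≤_ (lem₁ p q) (lem₂ p ε) (ℚ.+-monoˡ-≤ (ℚ.- p) q≤))
  where open +-*-Solver
        lem₁ : ∀ p q → q ℚ.- p ≡ ℚ.- (p ℚ.- q)
        lem₁ = solve 2 (λ p q → q :- p := :- (p :- q)) refl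
        lem₂ : ∀ p ε → p ℚ.+ ε ℚ.- p ≡ ε
        lem₂ = solve 2 (λ p ε → p :+ ε :- p := ε) refl

∣∣-triangle : ∀ p q → ∣ p ∣ ℚ.≤ ∣ q ∣ ℚ.+ ∣ p ℚ.- q ∣
∣∣-triangle p q = ℚ.≤-trans (ℚ.≤-reflexive (cong ∣_∣ (lem p q)))
                            (ℚ.∣p+q∣≤∣p∣+∣q∣ q (p ℚ.- q))
  where open +-*-Solver
        lem : ∀ p q → p ≡ q ℚ.+ (p ℚ.- q)
        lem = solve 2 (λ p q → p := q :+ (p :- q)) refl

0≤* : ∀ {p q} → 0ℚ ℚ.≤ p → 0ℚ ℚ.≤ q → 0ℚ ℚ.≤ p ℚ.* q
0≤* {p} {q} 0≤p 0≤q = ℚ.nonNegative⁻¹ (p ℚ.* q)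
  {{ℚ.nonNeg*nonNeg⇒nonNeg p {{ℚ.nonNegative 0≤p}} q {{ℚ.nonNegative 0≤q}}}}

0<* : ∀ {p q} → 0ℚ ℚ.< p → 0ℚ ℚ.< q → 0ℚ ℚ.< p ℚ.* q
0<* {p} {q} 0<p 0<q = ℚ.positive⁻¹ (p ℚ.* q)
  {{ℚ.pos*pos⇒pos p {{ℚ.positive 0<p}} q {{ℚ.positive 0<q}}}}

*-mono-≤ : ∀ {p q r s} → 0ℚ ℚ.≤ r → 0ℚ ℚ.≤ q →
           p ℚ.≤ q → r ℚ.≤ s → p ℚ.* r ℚ.≤ q ℚ.* s
*-mono-≤ {p} {q} {r} {s} 0≤r 0≤q p≤q r≤s = ℚ.≤-trans
  (ℚ.*-monoʳ-≤-nonNeg r {{ℚ.nonNegative 0≤r}} p≤q)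
  (ℚ.*-monoˡ-≤-nonNeg q {{ℚ.nonNegative 0≤q}} r≤s)

half : ∀ {ε} → 0ℚ ℚ.< ε → 0ℚ ℚ.< ½ ℚ.* ε
half = 0<* (ℚ.positive⁻¹ ½)

half+half : ∀ ε → ½ ℚ.* ε ℚ.+ ½ ℚ.* ε ≡ ε
half+half = solve 1 (λ ε → con ½ :* ε :+ con ½ :* ε := ε) refl
  where open +-*-Solver

IsCauchy : (ℕ → ℚ) → Set
IsCauchy x = ∀ ε → 0ℚ ℚ.< ε →
  ∃ λ N → ∀ m n → N ℕ.≤ m → N ℕ.≤ n → ∣ x m ℚ.- x n ∣ ℚ.≤ ε

-- Real numbers are Cauchy sequences of rationals; equality of reals is _≈_,
-- not _≡_.
record ℝ : Set where
  constructor mkℝ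
  field
    seq    : ℕ → ℚ
    cauchy : IsCauchy seq

open ℝ public

infix 4 _≈_ _<_ _≤_

_≈_ : ℝ → ℝ → Set
x ≈ y = ∀ ε → 0ℚ ℚ.< ε →
  ∃ λ N → ∀ n → N ℕ.≤ n → ∣ seq x n ℚ.- seq y n ∣ ℚ.≤ ε

_<_ : ℝ → ℝ → Set
x < y = ∃ λ ε → 0ℚ ℚ.< ε ×
  ∃ λ N → ∀ n → N ℕ.≤ n → seq x n ℚ.+ ε ℚ.≤ seq y n

-- The usual constructive order: ¬ ¬ (x ≤ y) implies x ≤ y.
_≤_ : ℝ → ℝ → Set
x ≤ y = ¬ (y < x)

fromℚ : ℚ → ℝ
fromℚ q = mkℝ (λ _ → q) λ ε 0<ε →
  0 , λ _ _ _ _ → subst (ℚ._≤ ε) (sym (cong ∣_∣ (ℚ.+-inverseʳ q))) (ℚ.<⇒≤ 0<ε)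

fromℕ : ℕ → ℝ
fromℕ n = fromℚ (+ n ℚ./ 1)

0ℝ 1ℝ : ℝ
0ℝ = fromℚ 0ℚ
1ℝ = fromℚ 1ℚ

abstract
  +-cauchy : ∀ x y → IsCauchy x → IsCauchy y → IsCauchy (λ n → x n ℚ.+ y n)
  +-cauchy x y cx cy ε 0<ε
    with cx (½ ℚ.* ε) (half 0<ε) | cy (½ ℚ.* ε) (half 0<ε)
  ... | N₁ , p₁ | N₂ , p₂ = N₁ ℕ.⊔ N₂ , λ m n N≤m N≤n →
    let open ℚ.≤-Reasoning in begin
      ∣ x m ℚ.+ y m ℚ.- (x n ℚ.+ y n) ∣
        ≡⟨ cong ∣_∣ (lem (x m) (y m) (x n) (y n)) ⟩
      ∣ (x m ℚ.- x n) ℚ.+ (y m ℚ.- y n) ∣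
        ≤⟨ ℚ.∣p+q∣≤∣p∣+∣q∣ (x m ℚ.- x n) (y m ℚ.- y n) ⟩
      ∣ x m ℚ.- x n ∣ ℚ.+ ∣ y m ℚ.- y n ∣
        ≤⟨ ℚ.+-mono-≤ (p₁ m n (ℕ.m⊔n≤o⇒m≤o N₁ N₂ N≤m) (ℕ.m⊔n≤o⇒m≤o N₁ N₂ N≤n))
                      (p₂ m n (ℕ.m⊔n≤o⇒n≤o N₁ N₂ N≤m) (ℕ.m⊔n≤o⇒n≤o N₁ N₂ N≤n)) ⟩
      ½ ℚ.* ε ℚ.+ ½ ℚ.* ε
        ≡⟨ half+half ε ⟩
      ε ∎
    where
    lem : ∀ a b c d → a ℚ.+ b ℚ.- (c ℚ.+ d) ≡ (a ℚ.- c) ℚ.+ (b ℚ.- d)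
    lem = solve 4 (λ a b c d → a :+ b :- (c :+ d) := (a :- c) :+ (b :- d)) refl
      where open +-*-Solver

abstract
  neg-cauchy : ∀ x → IsCauchy x → IsCauchy (λ n → ℚ.- x n)
  neg-cauchy x cx ε 0<ε with cx ε 0<ε
  ... | N , p = N , λ m n N≤m N≤n →
    subst (ℚ._≤ ε) (cong ∣_∣ (lem (x m) (x n))) (p n m N≤n N≤m)
    where
    lem : ∀ a b → b ℚ.- a ≡ ℚ.- a ℚ.- ℚ.- b
    lem = solve 2 (λ a b → b :- a := :- a :- :- b) refl
      where open +-*-Solver

eventuallyBounded : ∀ {x} → IsCauchy x →
  ∃ λ B → 0ℚ ℚ.< B × ∃ λ N → ∀ n → N ℕ.≤ n → ∣ x n ∣ ℚ.≤ B
eventuallyBounded {x} cx with cx 1ℚ (ℚ.positive⁻¹ 1ℚ)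
... | N , p = ∣ x N ∣ ℚ.+ 1ℚ
            , ℚ.+-mono-≤-< (ℚ.0≤∣p∣ (x N)) (ℚ.positive⁻¹ 1ℚ)
            , N
            , λ n N≤n → ℚ.≤-trans (∣∣-triangle (x n) (x N))
                          (ℚ.+-monoʳ-≤ ∣ x N ∣ (p n N N≤n ℕ.≤-refl))

fraction : ∀ {ε B} → 0ℚ ℚ.< ε → 0ℚ ℚ.< B → ∃ λ δ → 0ℚ ℚ.< δ × B ℚ.* δ ≡ ε
fraction {ε} {B} 0<ε 0<B = ℚ.1/ B ℚ.* ε , 0<* 0<1/B 0<ε , eq
  where
  instance
    B-pos : ℚ.Positive B
    B-pos = ℚ.positive 0<B
    B≢0 : ℚ.NonZero B
    B≢0 = ℚ.pos⇒nonZero B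
  0<1/B : 0ℚ ℚ.< ℚ.1/ B
  0<1/B = ℚ.positive⁻¹ (ℚ.1/ B) {{ℚ.1/pos⇒pos B}}
  eq : B ℚ.* (ℚ.1/ B ℚ.* ε) ≡ ε
  eq = trans (sym (ℚ.*-assoc B (ℚ.1/ B) ε))
             (trans (cong (ℚ._* ε) (ℚ.*-inverseʳ B)) (ℚ.*-identityˡ ε))

product-close : ∀ a b c d {ε} A B α β → 0ℚ ℚ.< A → 0ℚ ℚ.< B →
  A ℚ.* α ≡ ½ ℚ.* ε → B ℚ.* β ≡ ½ ℚ.* ε → ∣ a ∣ ℚ.≤ A → ∣ d ∣ ℚ.≤ B →
  ∣ a ℚ.- c ∣ ℚ.≤ β → ∣ b ℚ.- d ∣ ℚ.≤ α → ∣ a ℚ.* b ℚ.- c ℚ.* d ∣ ℚ.≤ ε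
product-close a b c d {ε} A B α β 0<A 0<B Aα≡ Bβ≡ a≤ d≤ a-c≤ b-d≤ = begin
    ∣ a ℚ.* b ℚ.- c ℚ.* d ∣
      ≡⟨ cong ∣_∣ (lem a b c d) ⟩
    ∣ a ℚ.* (b ℚ.- d) ℚ.+ d ℚ.* (a ℚ.- c) ∣
      ≤⟨ ℚ.∣p+q∣≤∣p∣+∣q∣ (a ℚ.* (b ℚ.- d)) (d ℚ.* (a ℚ.- c)) ⟩
    ∣ a ℚ.* (b ℚ.- d) ∣ ℚ.+ ∣ d ℚ.* (a ℚ.- c) ∣
      ≤⟨ ℚ.+-mono-≤ (bound a (b ℚ.- d) 0<A a≤ b-d≤) (bound d (a ℚ.- c) 0<B d≤ a-c≤) ⟩
    A ℚ.* α ℚ.+ B ℚ.* β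
      ≡⟨ trans (cong (ℚ._+ B ℚ.* β) Aα≡) (cong (½ ℚ.* ε ℚ.+_) Bβ≡) ⟩
    ½ ℚ.* ε ℚ.+ ½ ℚ.* ε
      ≡⟨ half+half ε ⟩
    ε ∎
  where
  open ℚ.≤-Reasoning
  lem : ∀ a b c d → a ℚ.* b ℚ.- c ℚ.* d ≡ a ℚ.* (b ℚ.- d) ℚ.+ d ℚ.* (a ℚ.- c)
  lem = solve 4 (λ a b c d → a :* b :- c :* d := a :* (b :- d) :+ d :* (a :- c)) refl
    where open +-*-Solver
  bound : ∀ a b {C γ} → 0ℚ ℚ.< C → ∣ a ∣ ℚ.≤ C → ∣ b ∣ ℚ.≤ γ → ∣ a ℚ.* b ∣ ℚ.≤ C ℚ.* γ
  bound a b {C} {γ} 0<C a≤ b≤ = subst (ℚ._≤ C ℚ.* γ) (sym (ℚ.∣p*q∣≡∣p∣*∣q∣ a b))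
    (*-mono-≤ (ℚ.0≤∣p∣ b) (ℚ.<⇒≤ 0<C) a≤ b≤)

abstract
  *-cauchy : ∀ x y → IsCauchy x → IsCauchy y → IsCauchy (λ n → x n ℚ.* y n)
  *-cauchy x y cx cy ε 0<ε =
    let A , 0<A , M₁ , bx = eventuallyBounded {x} cx
        B , 0<B , M₂ , by = eventuallyBounded {y} cy
        α , 0<α , Aα≡ = fraction (half 0<ε) 0<A
        β , 0<β , Bβ≡ = fraction (half 0<ε) 0<B
        N₁ , py = cy α 0<α
        N₂ , px = cx β 0<β
        M = M₁ ℕ.⊔ M₂
        N = N₁ ℕ.⊔ N₂
    in M ℕ.⊔ N , λ m n K≤m K≤n →
      let M≤m = ℕ.m⊔n≤o⇒m≤o M N K≤m ; M≤n = ℕ.m⊔n≤o⇒m≤o M N K≤n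
          N≤m = ℕ.m⊔n≤o⇒n≤o M N K≤m ; N≤n = ℕ.m⊔n≤o⇒n≤o M N K≤n
      in product-close (x m) (y m) (x n) (y n) A B α β 0<A 0<B Aα≡ Bβ≡
           (bx m (ℕ.m⊔n≤o⇒m≤o M₁ M₂ M≤m))
           (by n (ℕ.m⊔n≤o⇒n≤o M₁ M₂ M≤n))
           (px m n (ℕ.m⊔n≤o⇒n≤o N₁ N₂ N≤m) (ℕ.m⊔n≤o⇒n≤o N₁ N₂ N≤n))
           (py m n (ℕ.m⊔n≤o⇒m≤o N₁ N₂ N≤m) (ℕ.m⊔n≤o⇒m≤o N₁ N₂ N≤n))

infixl 6 _+_ _-_
infixl 7 _*_
infix  8 -_

_+_ _*_ : ℝ → ℝ → ℝ
x + y = mkℝ (λ n → seq x n ℚ.+ seq y n) (+-cauchy (seq x) (seq y) (cauchy x) (cauchy y))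
x * y = mkℝ (λ n → seq x n ℚ.* seq y n) (*-cauchy (seq x) (seq y) (cauchy x) (cauchy y))

-_ : ℝ → ℝ
- x = mkℝ (λ n → ℚ.- seq x n) (neg-cauchy (seq x) (cauchy x))

_-_ : ℝ → ℝ → ℝ
x - y = x + (- y)

isqrt : ℕ → ℕ
isqrt zero    = 0
isqrt (suc n) with isqrt n
... | k with suc k ℕ.* suc k ℕ.≤? suc n
...   | yes _ = suc k
...   | no  _ = k

isqrt-spec : ∀ n → isqrt n ℕ.* isqrt n ℕ.≤ n × n ℕ.< suc (isqrt n) ℕ.* suc (isqrt n)
isqrt-spec zero    = ℕ.z≤n , ℕ.s≤s ℕ.z≤n
isqrt-spec (suc n) with isqrt n | isqrt-spec n
... | k | k²≤n , n<sk² with suc k ℕ.* suc k ℕ.≤? suc n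
...   | yes sk²≤sn = sk²≤sn
                   , ℕ.≤-<-trans n<sk² (ℕ.*-mono-< (ℕ.n<1+n (suc k)) (ℕ.n<1+n (suc k)))
...   | no  sk²≰sn = ℕ.m≤n⇒m≤1+n k²≤n , ℕ.≰⇒> sk²≰sn

-- ⌊ √∣q∣ · N ⌋, using ⌊ √y ⌋ = ⌊ √⌊ y ⌋ ⌋ with y = ∣q∣ · N².
√-num : ℚ → ℕ → ℕ
√-num q N = isqrt (ℤ.∣ ↥ q ∣ ℕ.* (N ℕ.* N) ℕ./ ↧ₙ q)

√ℚ : ℚ → (N : ℕ) .{{_ : ℕ.NonZero N}} → ℚ
√ℚ q N = + √-num q N ℚ./ N

toℚᵘ-square : ∀ s n → ℚ.toℚᵘ ((+ s ℚ./ suc n) ℚ.* (+ s ℚ./ suc n))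
              ℚᵘ.≃ ℚᵘ.mkℚᵘ (+ s) n ℚᵘ.* ℚᵘ.mkℚᵘ (+ s) n
toℚᵘ-square s n = ℚᵘ.≃-trans (ℚ.toℚᵘ-homo-* (+ s ℚ./ suc n) (+ s ℚ./ suc n))
  (ℚᵘ.*-cong (ℚ.toℚᵘ-fromℚᵘ (ℚᵘ.mkℚᵘ (+ s) n)) (ℚ.toℚᵘ-fromℚᵘ (ℚᵘ.mkℚᵘ (+ s) n)))

√ℚ-lower : ∀ q n → √ℚ q (suc n) ℚ.* √ℚ q (suc n) ℚ.≤ ∣ q ∣
√ℚ-lower q@(ℚ.mkℚ p d-1 _) n = ℚ.toℚᵘ-cancel-≤
  (ℚᵘ.≤-trans (ℚᵘ.≤-reflexive (toℚᵘ-square s n)) (ℚᵘ.*≤* ineq))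
  where
  N = suc n
  P = ℤ.∣ p ∣
  d = suc d-1
  k = P ℕ.* (N ℕ.* N) ℕ./ d
  s = √-num q N
  nat : s ℕ.* s ℕ.* d ℕ.≤ P ℕ.* (N ℕ.* N)
  nat = ℕ.≤-trans (ℕ.*-monoˡ-≤ d (proj₁ (isqrt-spec k))) (ℕ.m/n*n≤m (P ℕ.* (N ℕ.* N)) d)
  ineq : + s ℤ.* + s ℤ.* + d ℤ.≤ + P ℤ.* + (N ℕ.* N)
  ineq = subst₂ ℤ._≤_
    (trans (ℤ.pos-* (s ℕ.* s) d) (cong (ℤ._* + d) (ℤ.pos-* s s)))
    (ℤ.pos-* P (N ℕ.* N)) (ℤ.+≤+ nat)

√ℚ-upper : ∀ q n → let t = + suc (√-num q (suc n)) ℚ./ suc n in ∣ q ∣ ℚ.≤ t ℚ.* t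
√ℚ-upper q@(ℚ.mkℚ p d-1 _) n = ℚ.toℚᵘ-cancel-≤
  (ℚᵘ.≤-trans (ℚᵘ.*≤* ineq) (ℚᵘ.≤-reflexive (ℚᵘ.≃-sym (toℚᵘ-square s n))))
  where
  N = suc n
  P = ℤ.∣ p ∣
  d = suc d-1
  a = P ℕ.* (N ℕ.* N)
  k = a ℕ./ d
  s = suc (√-num q N)
  nat : a ℕ.≤ s ℕ.* s ℕ.* d
  nat = let open ℕ.≤-Reasoning in begin
    a                     ≡⟨ ℕ.m≡m%n+[m/n]*n a d ⟩
    a ℕ.% d ℕ.+ k ℕ.* d   ≤⟨ ℕ.+-monoˡ-≤ (k ℕ.* d) (ℕ.<⇒≤ (ℕ.m%n<n a d)) ⟩
    suc k ℕ.* d           ≤⟨ ℕ.*-monoˡ-≤ d (proj₂ (isqrt-spec k)) ⟩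
    s ℕ.* s ℕ.* d         ∎
  ineq : + P ℤ.* + (N ℕ.* N) ℤ.≤ + s ℤ.* + s ℤ.* + d
  ineq = subst₂ ℤ._≤_ (ℤ.pos-* P (N ℕ.* N))
    (trans (ℤ.pos-* (s ℕ.* s) d) (cong (ℤ._* + d) (ℤ.pos-* s s)))
    (ℤ.+≤+ nat)

suc-/ : ∀ s n → + suc s ℚ./ suc n ≡ + s ℚ./ suc n ℚ.+ + 1 ℚ./ suc n
suc-/ s n = ℚ.toℚᵘ-injective (ℚᵘ.≃-trans (ℚ.toℚᵘ-fromℚᵘ (ℚᵘ.mkℚᵘ (+ suc s) n))
  (ℚᵘ.≃-sym (ℚᵘ.≃-trans (ℚ.toℚᵘ-homo-+ (+ s ℚ./ suc n) (+ 1 ℚ./ suc n))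
    (ℚᵘ.≃-trans (ℚᵘ.+-cong (ℚ.toℚᵘ-fromℚᵘ (ℚᵘ.mkℚᵘ (+ s) n)) (ℚ.toℚᵘ-fromℚᵘ (ℚᵘ.mkℚᵘ (+ 1) n)))
      (ℚᵘ.*≡* (trans (cong (ℤ._* + N) (sym (ℤ.*-distribʳ-+ (+ N) (+ s) (+ 1))))
        (trans (ℤ.*-assoc (+ s ℤ.+ + 1) (+ N) (+ N))
          (trans (cong (λ z → + z ℤ.* (+ N ℤ.* + N)) (ℕ.+-comm s 1))
            (cong (+ suc s ℤ.*_) (sym (ℤ.pos-* N N)))))))))))
  where N = suc n

/-nonNeg : ∀ s n → 0ℚ ℚ.≤ + s ℚ./ suc n
/-nonNeg s n = ℚ.nonNegative⁻¹ (+ s ℚ./ suc n) {{ℚ.normalize-nonNeg s (suc n)}}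

archimedean : ∀ {δ} → 0ℚ ℚ.< δ → ∃ λ N → ∀ n → N ℕ.≤ n → + 1 ℚ./ suc n ℚ.≤ δ
archimedean {δ@(ℚ.mkℚ (+ suc p) d-1 _)} 0<δ = d-1 , λ n d-1≤n → ℚ.toℚᵘ-cancel-≤
  (ℚᵘ.≤-trans (ℚᵘ.≤-reflexive (ℚ.toℚᵘ-fromℚᵘ (ℚᵘ.mkℚᵘ (+ 1) n)))
    (ℚᵘ.*≤* (subst₂ ℤ._≤_ (ℤ.pos-* 1 (suc d-1)) (ℤ.pos-* (suc p) (suc n))
      (ℤ.+≤+ (ℕ.*-mono-≤ (ℕ.s≤s (ℕ.z≤n {p})) (ℕ.s≤s d-1≤n))))))
archimedean {ℚ.mkℚ (+ zero) d-1 _} (ℚ.*<* (ℤ.+<+ ()))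
archimedean {ℚ.mkℚ ℤ.-[1+ _ ] _ _} (ℚ.*<* ())

√-step : ∀ {r t q q′ δ} → 0ℚ ℚ.≤ t → 0ℚ ℚ.< δ →
         r ℚ.* r ℚ.≤ q → q ℚ.≤ q′ ℚ.+ δ ℚ.* δ → q′ ℚ.≤ t ℚ.* t → r ℚ.≤ t ℚ.+ δ
√-step {r} {t} {q} {q′} {δ} 0≤t 0<δ r²≤q q≤ q′≤t² = ℚ.≮⇒≥ λ u<r →
  ℚ.<-irrefl refl (ℚ.<-≤-trans (square-< u<r) (ℚ.≤-trans r²≤q
    (ℚ.≤-trans q≤ (ℚ.≤-trans (ℚ.+-monoˡ-≤ (δ ℚ.* δ) q′≤t²) square-≤))))
  where
  u = t ℚ.+ δ
  0<u : 0ℚ ℚ.< u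
  0<u = ℚ.+-mono-≤-< 0≤t 0<δ
  square-< : u ℚ.< r → u ℚ.* u ℚ.< r ℚ.* r
  square-< u<r = ℚ.<-trans
    (ℚ.*-monoʳ-<-pos u {{ℚ.positive 0<u}} u<r)
    (ℚ.*-monoˡ-<-pos r {{ℚ.positive (ℚ.<-trans 0<u u<r)}} u<r)
  square-≤ : t ℚ.* t ℚ.+ δ ℚ.* δ ℚ.≤ u ℚ.* u
  square-≤ = subst₂ ℚ._≤_ (ℚ.+-identityʳ _) (lem t δ)
    (ℚ.+-monoʳ-≤ (t ℚ.* t ℚ.+ δ ℚ.* δ)
      (ℚ.+-mono-≤ (0≤* 0≤t (ℚ.<⇒≤ 0<δ)) (0≤* 0≤t (ℚ.<⇒≤ 0<δ))))
    where
    lem : ∀ t δ → t ℚ.* t ℚ.+ δ ℚ.* δ ℚ.+ (t ℚ.* δ ℚ.+ t ℚ.* δ) ≡ (t ℚ.+ δ) ℚ.* (t ℚ.+ δ)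
    lem = solve 2 (λ t δ → t :* t :+ δ :* δ :+ (t :* δ :+ t :* δ) := (t :+ δ) :* (t :+ δ)) refl
      where open +-*-Solver

√ℚ-close : ∀ p q {δ} n m → 0ℚ ℚ.< δ → ∣ p ℚ.- q ∣ ℚ.≤ δ ℚ.* δ → + 1 ℚ./ suc n ℚ.≤ δ →
           √ℚ p (suc m) ℚ.≤ √ℚ q (suc n) ℚ.+ (δ ℚ.+ δ)
√ℚ-close p q {δ} n m 0<δ ∣p-q∣≤ 1/n≤δ = begin
    √ℚ p (suc m)
      ≤⟨ √-step {r = √ℚ p (suc m)} (/-nonNeg (suc s) n) 0<δ (√ℚ-lower p m)
           (ℚ.≤-trans (∣∣-triangle p q) (ℚ.+-monoʳ-≤ ∣ q ∣ ∣p-q∣≤)) (√ℚ-upper q n) ⟩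
    + suc s ℚ./ suc n ℚ.+ δ
      ≡⟨ cong (ℚ._+ δ) (suc-/ s n) ⟩
    √ℚ q (suc n) ℚ.+ + 1 ℚ./ suc n ℚ.+ δ
      ≤⟨ ℚ.+-monoˡ-≤ δ (ℚ.+-monoʳ-≤ (√ℚ q (suc n)) 1/n≤δ) ⟩
    √ℚ q (suc n) ℚ.+ δ ℚ.+ δ
      ≡⟨ ℚ.+-assoc (√ℚ q (suc n)) δ δ ⟩
    √ℚ q (suc n) ℚ.+ (δ ℚ.+ δ) ∎
  where
  open ℚ.≤-Reasoning
  s = √-num q (suc n)

abstract
  √-cauchy : ∀ x → IsCauchy x → IsCauchy (λ n → √ℚ (x n) (suc n))
  √-cauchy x cx ε 0<ε =
    let 0<δ = half 0<ε
        N₁ , p = cx _ (0<* 0<δ 0<δ)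
        N₂ , a = archimedean 0<δ
        close : ∀ m n → N₁ ℕ.⊔ N₂ ℕ.≤ m → N₁ ℕ.⊔ N₂ ℕ.≤ n →
                √ℚ (x m) (suc m) ℚ.≤ √ℚ (x n) (suc n) ℚ.+ ε
        close m n N≤m N≤n = subst (λ η → √ℚ (x m) (suc m) ℚ.≤ √ℚ (x n) (suc n) ℚ.+ η) (half+half ε)
          (√ℚ-close (x m) (x n) n m 0<δ
            (p m n (ℕ.m⊔n≤o⇒m≤o N₁ N₂ N≤m) (ℕ.m⊔n≤o⇒m≤o N₁ N₂ N≤n))
            (a n (ℕ.m⊔n≤o⇒n≤o N₁ N₂ N≤n)))
    in N₁ ℕ.⊔ N₂ , λ m n N≤m N≤n → ∣-∣≤ (close m n N≤m N≤n) (close n m N≤n N≤m)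

-- Made total as √∣x∣; it is applied only to sums of squares.
√ : ℝ → ℝ
√ x = mkℝ (λ n → √ℚ (seq x n) (suc n)) (√-cauchy (seq x) (cauchy x))

𝔼 : ℕ → Set
𝔼 n = Vector ℝ n

infix 4 _≋_

_≋_ : ∀ {n} → 𝔼 n → 𝔼 n → Set
_≋_ = Pointwise _≈_

+-rawMonoid : RawMonoid 0ℓ 0ℓ
+-rawMonoid = record { Carrier = ℝ ; _≈_ = _≈_ ; _∙_ = _+_ ; ε = 0ℝ }

open RawMonoidDefs +-rawMonoid public using (sum)

⟪_,_⟫ : ∀ {n} → 𝔼 n → 𝔼 n → ℝ
⟪ u , v ⟫ = sum (λ i → u i * v i)

‖_‖ : ∀ {n} → 𝔼 n → ℝ
‖ v ‖ = √ ⟪ v , v ⟫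

record Subspace (n : ℕ) : Set₁ where
  field
    Mem    : Pred (𝔼 n) 0ℓ
    resp-≋ : ∀ {u v} → u ≋ v → Mem u → Mem v
    0∈     : Mem (λ _ → 0ℝ)
    +∈     : ∀ {u v} → Mem u → Mem v → Mem (λ i → u i + v i)
    *∈     : ∀ c {v} → Mem v → Mem (λ i → c * v i)

linearCombination : ∀ {k n} → (Fin k → ℝ) → (Fin k → 𝔼 n) → 𝔼 n
linearCombination c b i = sum (λ j → c j * b j i)

record HasDimension {n : ℕ} (V : Subspace n) (k : ℕ) : Set where
  open Subspace V
  field
    basis       : Fin k → 𝔼 n
    basis∈      : ∀ j → Mem (basis j)
    independent : ∀ c → linearCombination c basis ≋ (λ _ → 0ℝ) → ∀ j → c j ≈ 0ℝ
    spanning    : ∀ v → Mem v → ∃ λ c → v ≋ linearCombination c basis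

record IsSupremum (S : ℕ → Set₁) (s : ℝ) : Set₁ where
  field
    upperBound : ∀ k → S k → fromℕ k ≤ s
    least      : ∀ t → (∀ k → S k → fromℕ k ≤ t) → s ≤ t

BoundedDimension : ∀ {m n} → (𝔼 m → 𝔼 n) → ℝ → ℕ → Set₁
BoundedDimension {m} f r k = Σ (Subspace m) λ V₀ →
  HasDimension V₀ k × (∀ v → Subspace.Mem V₀ v → ‖ f v ‖ ≤ r * ‖ v ‖)

-- IsSpectralDensity f r s says that F(f)(r) = s.  It is a relation because the
-- supremum, even of a bounded set of naturals, cannot be computed
-- constructively in general.  It is applied only to linear f.
IsSpectralDensity : ∀ {m n} → (𝔼 m → 𝔼 n) → ℝ → ℝ → Set₁
IsSpectralDensity f r = IsSupremum (BoundedDimension f r)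

-- Loops and multiple edges are allowed; an edge e is oriented from v₀ e to v₁ e.
record Graph : Set where
  field
    #V #E : ℕ
    v₀ v₁ : Fin #E → Fin #V

module _ (X : Graph) where
  open Graph X

  OneEndpoint BothEndpoints : Fin #V → Pred (Fin #E) 0ℓ
  OneEndpoint   v e = (v₀ e ≡ v × v₁ e ≢ v) ⊎ (v₀ e ≢ v × v₁ e ≡ v)
  BothEndpoints v e = v₀ e ≡ v × v₁ e ≡ v

  oneEndpoint? : ∀ v → Decidable (OneEndpoint v)
  oneEndpoint? v e = ((v₀ e Fin.≟ v) ×-dec ¬? (v₁ e Fin.≟ v))
               ⊎-dec (¬? (v₀ e Fin.≟ v) ×-dec (v₁ e Fin.≟ v))

  bothEndpoints? : ∀ v → Decidable (BothEndpoints v)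
  bothEndpoints? v e = (v₀ e Fin.≟ v) ×-dec (v₁ e Fin.≟ v)

  degreeAt : Fin #V → ℕ
  degreeAt v = length (filter (oneEndpoint? v) (allFin #E))
         ℕ.+ 2 ℕ.* length (filter (bothEndpoints? v) (allFin #E))

  -- The empty graph is given degree 0.
  deg : ℕ
  deg = foldr ℕ._⊔_ 0 degreeAt

  c₁ : 𝔼 #E → 𝔼 #V
  c₁ a v = sum (λ e → if does (v₁ e Fin.≟ v) then a e else 0ℝ)
         - sum (λ e → if does (v₀ e Fin.≟ v) then a e else 0ℝ)

  IsF₁ : ℝ → ℝ → Set₁
  IsF₁ = IsSpectralDensity c₁

{-# OPTIONS --safe #-}

-- Restrict to an a ∈ C₁ that is orthogonal to the fundamental cycles of a
-- spanning forest; these are independent elements of ker c₁.  Then a = δx, where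
-- the potential x vanishes at the roots of the forest, and |a|² = ⟨x , c₁ a⟩.
-- Walk around the forest, using each of its edges once in each direction, and
-- cut this tour, of length at most 2|E|, into pieces of length M (leaving a
-- shorter remainder).  Suppose also that the sum of a along each piece vanishes:
-- at most 2|E|/M linear conditions.  Then x vanishes at the ends of the pieces,
-- and Cauchy–Schwarz on each piece gives |x|² ≤ ½ M(M−1) |a|².  So if
-- |c₁ a| ≤ q |a| with (M−1) q < 1 ≤ M q and q < 1, then a = 0.  Hence a subspace
-- on which |c₁ a| ≤ q |a| has dimension at most that of the kernel plus
-- 2|E|/M ≤ 2|E|q.  Rational q is enough, since any rational q > λ may be taken.

module Submission where

open import Algebra.Bundles using (CommutativeRing)
import Algebra.Properties.Ring as RingProperties
import Algebra.Properties.Semiring.Sum as SemiringSum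
import Algebra.Solver.Ring as RingSolver
open import Algebra.Solver.Ring.AlmostCommutativeRing using (fromCommutativeRing; _-Raw-AlmostCommutative⟶_)
open import Data.Bool.Base using (Bool; true; false; not; if_then_else_)
open import Data.Empty using (⊥)
open import Data.Fin.Base using (Fin; zero; suc; punchIn)
import Data.Fin.Properties as Fin
open import Data.Integer.Base as ℤ using ()
import Data.Integer.Properties as ℤ
open import Data.List.Base as List using (List; []; _∷_; _++_; map; length; filter; allFin; concat; take; drop; lookup)
open import Data.List.Membership.DecPropositional as DecMembership using ()
open import Data.List.Membership.Propositional using (_∈_; _∉_; lose)
open import Data.List.Membership.Propositional.Properties
  using (∈-filter⁺; ∈-filter⁻; ∈-∃++; ∈-++⁻; ∈-allFin; ∈-++⁺ˡ; ∈-++⁺ʳ; ∈-map⁺; ∈-lookup)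
import Data.List.Properties as List
open import Data.List.Relation.Binary.Permutation.Propositional
  using (_↭_; ↭-refl; ↭-sym; ↭-trans; ↭-reflexive; ↭⇒↭ₛ; prep)
  renaming (refl to ↭refl; swap to ↭swap; trans to ↭trans)
open import Data.List.Relation.Binary.Permutation.Propositional.Properties using (shift; ++⁺ˡ; ∈-resp-↭; ↭-length)
import Data.List.Relation.Binary.Permutation.Setoid.Properties as SetoidPermutation
open import Data.List.Relation.Unary.All as All using ([]; _∷_)
open import Data.List.Relation.Unary.AllPairs using ([]; _∷_)
open import Data.List.Relation.Unary.Any as Any using (here; there)
open import Data.List.Relation.Unary.Any.Properties using (lookup-index)
open import Data.List.Relation.Unary.Unique.Propositional using (Unique)
import Data.List.Relation.Unary.Unique.Propositional.Properties as Unique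
open import Data.Maybe.Base as Maybe using (Maybe)
open import Data.Nat.Base as ℕ using (ℕ; zero; suc; _∸_)
import Data.Nat.Properties as ℕ
open import Data.Product.Base using (∃; ∃₂; _×_; _,_; proj₁; proj₂)
open import Data.Rational.Base as ℚ using (ℚ; 0ℚ; 1ℚ; ½; ∣_∣)
import Data.Rational.Properties as ℚ
open import Data.Rational.Solver as ℚ using ()
import Data.Rational.Unnormalised.Base as ℚᵘ
import Data.Rational.Unnormalised.Properties as ℚᵘ
open import Data.Sum.Base using (_⊎_; inj₁; inj₂)
open import Data.Vec.Functional using (foldr; insertAt; updateAt)
open import Data.Vec.Functional.Properties
  using (insertAt-lookup; insertAt-punchIn; updateAt-updates; updateAt-minimal)
open import Function.Base using (const; _∘_; id)
open import Level using (0ℓ)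
open import Relation.Binary.Bundles using (Preorder)
open import Relation.Binary.PropositionalEquality as ≡ using (_≡_; _≢_; cong; cong₂; subst; subst₂)
import Relation.Binary.Reasoning.Preorder as PreorderReasoning
import Relation.Binary.Reasoning.Setoid as SetoidReasoning
open import Relation.Nullary using (¬_; Dec; does; yes; no; contradiction; ¬?; _×-dec_; _⊎-dec_; dec⇒maybe)
open import Relation.Nullary.Decidable using (map′; dec-true; dec-false; ¬¬-excluded-middle)

open import Defs using (Graph; suc-/; /-nonNeg)

-- Linear algebra over an ordered ℚ-algebra

-- Where ½M(M-1) comes from: on a closed walk with n edges, twice a partial sum of a is a signed sum
-- of a over all n edges, so the square of the partial sum is at most n/4 times the energy of the
-- walk; at most n-1 partial sums are nonzero, and the tour counts each forest edge twice. With κ =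
-- M(M-1) this gives |a|² = ⟨x , c₁ a⟩ ≤ √(κ/2) q |a|², and κq² = (M-1)q · Mq < 2, since Mq < 1 + q
-- < 2. The obstacle is constructivity: a real cannot be tested for zero, knowing that it is nonzero
-- does not yield an inverse, and M cannot be read off from a real λ. So linear systems are solved
-- without division and up to double negation, Cauchy-Schwarz is used without square roots, and M is
-- found by search for a rational q. The linear algebra is done over an abstract ordered algebra
-- because equality and order of the reals unfold to statements about sequences, from which the two
-- reals cannot be inferred as implicit arguments.

record OrderedℚAlgebra : Set₁ where
  field
    ring : CommutativeRing 0ℓ 0ℓ
  open CommutativeRing ring public hiding (ring; zero)
  field
    coefficients : ℚ.+-*-rawRing -Raw-AlmostCommutative⟶ fromCommutativeRing ring
  open _-Raw-AlmostCommutative⟶_ coefficients public using () renaming (⟦_⟧ to ι)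
  infix 4 _≤_ _<_
  field
    _≤_ _<_     : Carrier → Carrier → Set
    ≤-reflexive : ∀ {x y} → x ≈ y → x ≤ y
    ≤-trans     : ∀ {x y z} → x ≤ y → y ≤ z → x ≤ z
    ≤-antisym   : ∀ {x y} → x ≤ y → y ≤ x → x ≈ y
    +-mono-≤    : ∀ {x y z w} → x ≤ y → z ≤ w → x + z ≤ y + w
    0≤x*y       : ∀ {x y} → 0# ≤ x → 0# ≤ y → 0# ≤ x * y
    0<x*y       : ∀ {x y} → 0# < x → 0# < y → 0# < x * y
    ≮⇒≥         : ∀ {x y} → ¬ (x < y) → y ≤ x
    ≤⇒≯         : ∀ {x y} → x ≤ y → ¬ (y < x)
    0≤x²        : ∀ x → 0# ≤ x * x
    x²≤0⇒x≈0    : ∀ {x} → x * x ≤ 0# → x ≈ 0#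
    ι-mono-≤    : ∀ {p q} → p ℚ.≤ q → ι p ≤ ι q
    0<1         : 0# < 1#

module Sums (K : OrderedℚAlgebra) where
  open OrderedℚAlgebra K public
  open RingProperties (CommutativeRing.ring ring) public using (-0#≈0#)
  open SemiringSum semiring public
    using (sum; sum-cong-≋; sum-remove; ∑-distrib-+; ∑-comm; *-distribˡ-sum; *-distribʳ-sum; sum-replicate-zero)

  ι-cong? : ∀ p q → Maybe (ι p ≈ ι q)
  ι-cong? p q = Maybe.map (λ p≡q → reflexive (cong ι p≡q)) (dec⇒maybe (p ℚ.≟ q))

  module Solver = RingSolver ℚ.+-*-rawRing (fromCommutativeRing ring) coefficients ι-cong?

  ≤-preorder : Preorder 0ℓ 0ℓ 0ℓ
  ≤-preorder = record { isPreorder = record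
    { isEquivalence = isEquivalence ; reflexive = ≤-reflexive ; trans = ≤-trans } }

  module ≤-Reasoning = PreorderReasoning ≤-preorder

  module ≈-Reasoning = SetoidReasoning setoid

  ≤-refl : ∀ {x} → x ≤ x
  ≤-refl = ≤-reflexive refl

  -- Stability replaces case distinctions on elements: equations and inequalities may be proved by
  -- contradiction.
  ≤-stable : ∀ {x y} → ¬ ¬ (x ≤ y) → x ≤ y
  ≤-stable ¬¬x≤y = ≮⇒≥ λ y<x → ¬¬x≤y λ x≤y → ≤⇒≯ x≤y y<x

  ≈-stable : ∀ {x y} → ¬ ¬ (x ≈ y) → x ≈ y
  ≈-stable ¬¬x≈y = ≤-antisym (≤-stable λ x≰y → ¬¬x≈y λ x≈y → x≰y (≤-reflexive x≈y))
                             (≤-stable λ y≰x → ¬¬x≈y λ x≈y → y≰x (≤-reflexive (sym x≈y)))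

  1≉0 : ¬ (1# ≈ 0#)
  1≉0 1≈0 = ≤⇒≯ (≤-reflexive 1≈0) 0<1

  ι1≈1 : ι 1ℚ ≈ 1#
  ι1≈1 = _-Raw-AlmostCommutative⟶_.1-homo coefficients

  ι-+ : ∀ p q → ι (p ℚ.+ q) ≈ ι p + ι q
  ι-+ = _-Raw-AlmostCommutative⟶_.+-homo coefficients

  ι0≈0 : ι 0ℚ ≈ 0#
  ι0≈0 = _-Raw-AlmostCommutative⟶_.0-homo coefficients

  c*x≤0⇒x≤0 : ∀ {c x} → 0# < c → c * x ≤ 0# → x ≤ 0#
  c*x≤0⇒x≤0 0<c cx≤0 = ≮⇒≥ λ 0<x → ≤⇒≯ cx≤0 (0<x*y 0<c 0<x)

  -- With no inverse of `x` at hand, the positive square is cancelled instead: if 0 < x², then x²y²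
  -- = 0 forces y² ≤ 0. Otherwise x² ≤ 0, against `x≉0`.
  x*y≈0⇒y≈0 : ∀ {x y} → ¬ (x ≈ 0#) → x * y ≈ 0# → y ≈ 0#
  x*y≈0⇒y≈0 {x} {y} x≉0 xy≈0 = ≈-stable λ y≉0 → x≉0 (x²≤0⇒x≈0 (≮⇒≥ λ 0<x² →
    y≉0 (x²≤0⇒x≈0 (c*x≤0⇒x≤0 0<x² (≤-reflexive (begin
      x * x * (y * y)    ≈⟨ solve 2 (λ x y → x :* x :* (y :* y) := x :* y :* (x :* y)) refl x y ⟩
      x * y * (x * y)    ≈⟨ *-congʳ xy≈0 ⟩
      0# * (x * y)       ≈⟨ zeroˡ (x * y) ⟩
      0#                 ∎))))))
    where
    open Solver
    open ≈-Reasoning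

  sum-linear : ∀ {n} a b (f g : Fin n → Carrier) →
               sum (λ i → a * f i + b * g i) ≈ a * sum f + b * sum g
  sum-linear a b f g = trans (∑-distrib-+ (λ i → a * f i) (λ i → b * g i))
    (sym (+-cong (*-distribˡ-sum a f) (*-distribˡ-sum b g)))

  sum-zero : ∀ {n} {f : Fin n → Carrier} → (∀ i → f i ≈ 0#) → sum f ≈ 0#
  sum-zero {n} f≈0 = trans (sum-cong-≋ f≈0) (sum-replicate-zero n)

  sum-mono-≤ : ∀ {n} {f g : Fin n → Carrier} → (∀ i → f i ≤ g i) → sum f ≤ sum g
  sum-mono-≤ {zero}  f≤g = ≤-refl
  sum-mono-≤ {suc n} f≤g = +-mono-≤ (f≤g zero) (sum-mono-≤ λ i → f≤g (suc i))

  sum-select : ∀ {n} (i : Fin n) (f : Fin n → Carrier) → (∀ j → j ≢ i → f j ≈ 0#) → sum f ≈ f i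
  sum-select {suc n} i f f≈0 = trans (sum-remove f)
    (trans (+-congˡ (sum-zero λ j → f≈0 (punchIn i j) (Fin.punchInᵢ≢i i j))) (+-identityʳ (f i)))

  -- Fraction-free Gaussian elimination: the pivot is only known to be nonzero,
  -- which does not make it invertible.
  nontrivialSolution : ∀ m {n} → m ℕ.< n → (M : Fin m → Fin n → Carrier) →
    ¬ ¬ (∃ λ (c : Fin n → Carrier) → (∃ λ (j : Fin n) → ¬ (c j ≈ 0#)) × ∀ i → sum (λ j → M i j * c j) ≈ 0#)
  nontrivialSolution zero    {suc n} _ M none = none ((λ _ → 1#) , (zero , 1≉0) , λ ())
  -- Whether the first row contains a nonzero entry is undecidable; excluded middle is available
  -- here because the goal is `⊥`.
  nontrivialSolution (suc m) {suc n} (ℕ.s≤s m<n) M none = ¬¬-excluded-middle λ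
    { (no zeroRow) → nontrivialSolution m (ℕ.m<n⇒m<1+n m<n) (λ i → M (suc i)) λ (c , c≉0 , Mc≈0) →
        none (c , c≉0 , λ
          { zero → sum-zero λ j → trans (*-congʳ (≈-stable λ M₀j≉0 → zeroRow (j , M₀j≉0))) (zeroˡ (c j))
          ; (suc i) → Mc≈0 i })
    ; (yes (j , M₀j≉0)) → eliminate j M₀j≉0 }
    where
    eliminate : ∀ j → ¬ (M zero j ≈ 0#) → ⊥
    eliminate j M₀j≉0 = nontrivialSolution m m<n M′ λ (c′ , (l , c′l≉0) , M′c′≈0) →
      let
        s = sum (λ l → row zero l * c′ l)
        -- Back substitution would put -s/p at `j`; multiplying the whole solution by the pivot `p`
        -- avoids the quotient.
        c = insertAt (λ l → p * c′ l) j (- s)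
        expand : ∀ i → sum (λ j → M i j * c j) ≈ p * sum (λ l → row i l * c′ l) + (- M i j) * s
        expand i = begin
          sum (λ j → M i j * c j)
            ≈⟨ sum-remove (λ j → M i j * c j) ⟩
          M i j * c j + sum (λ l → row i l * c (punchIn j l))
            ≈⟨ +-cong (*-congˡ (reflexive (insertAt-lookup (λ l → p * c′ l) j (- s))))
                 (sum-cong-≋ λ l → trans (*-congˡ (reflexive (insertAt-punchIn (λ l → p * c′ l) j (- s) l)))
                   (solve 3 (λ a p b → a :* (p :* b) := p :* (a :* b)) refl (row i l) p (c′ l))) ⟩
          M i j * (- s) + sum (λ l → p * (row i l * c′ l))
            ≈⟨ +-congˡ (sym (*-distribˡ-sum p (λ l → row i l * c′ l))) ⟩
          M i j * (- s) + p * sum (λ l → row i l * c′ l)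
            ≈⟨ solve 4 (λ a s p t → a :* (:- s) :+ p :* t := p :* t :+ (:- a) :* s) refl
                 (M i j) s p (sum (λ l → row i l * c′ l)) ⟩
          p * sum (λ l → row i l * c′ l) + (- M i j) * s ∎
      in none (c
        , (punchIn j l , λ cl≈0 → c′l≉0 (x*y≈0⇒y≈0 M₀j≉0
            (trans (sym (reflexive (insertAt-punchIn (λ l → p * c′ l) j (- s) l))) cl≈0)))
        , λ { zero → trans (expand zero)
                (trans (solve 2 (λ p s → p :* s :+ (:- p) :* s := con 0ℚ) refl p s) ι0≈0)
            ; (suc i) → trans (expand (suc i)) (trans (sym (begin
                sum (λ l → M′ i l * c′ l)
                  ≈⟨ sum-cong-≋ (λ l → solve 5 (λ p a q b c → (p :* a :- q :* b) :* c := p :* (a :* c) :+ (:- q) :* (b :* c)) refl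
                       p (row (suc i) l) (M (suc i) j) (row zero l) (c′ l)) ⟩
                sum (λ l → p * (row (suc i) l * c′ l) + (- M (suc i) j) * (row zero l * c′ l))
                  ≈⟨ sum-linear p (- M (suc i) j) (λ l → row (suc i) l * c′ l) (λ l → row zero l * c′ l) ⟩
                p * sum (λ l → row (suc i) l * c′ l) + (- M (suc i) j) * s ∎)) (M′c′≈0 i)) })
      where
      open ≈-Reasoning
      open Solver
      p = M zero j
      row : Fin (suc m) → Fin n → Carrier
      row i l = M i (punchIn j l)
      M′ : Fin m → Fin n → Carrier
      M′ i l = p * row (suc i) l - M (suc i) j * row zero l

-- Lists

-- Two positions on one list are comparable. When a detour is spliced into the tour, this tells
-- whether the position kept for another vertex comes before or after it.
++-splits : ∀ {A : Set} (p₁ s₁ p₂ s₂ : List A) → p₁ ++ s₁ ≡ p₂ ++ s₂ →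
            (∃ λ r → p₂ ≡ p₁ ++ r × s₁ ≡ r ++ s₂) ⊎ (∃ λ r → p₁ ≡ p₂ ++ r × s₂ ≡ r ++ s₁)
++-splits []       s₁ p₂       s₂ eq = inj₁ (p₂ , ≡.refl , eq)
++-splits (x ∷ p₁) s₁ []       s₂ eq = inj₂ (x ∷ p₁ , ≡.refl , ≡.sym eq)
++-splits (x ∷ p₁) s₁ (y ∷ p₂) s₂ eq with List.∷-injective eq
... | ≡.refl , eq′ with ++-splits p₁ s₁ p₂ s₂ eq′
...   | inj₁ (r , eq₁ , eq₂) = inj₁ (r , cong (x ∷_) eq₁ , eq₂)
...   | inj₂ (r , eq₁ , eq₂) = inj₂ (r , cong (x ∷_) eq₁ , eq₂)

module _ {A : Set} where
  unique-++ : ∀ (xs : List A) {ys} → Unique (xs ++ ys) → Unique ys × (∀ {x} → x ∈ xs → x ∉ ys)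
  unique-++ []       u        = u , λ ()
  unique-++ (x ∷ xs) (x∉ ∷ u) with unique-++ xs u
  ... | uys , disjoint = uys , λ
    { (here ≡.refl) x∈ys → All.lookup x∉ (∈-++⁺ʳ xs x∈ys) ≡.refl
    ; (there x∈xs) → disjoint x∈xs }

  lookup-injective : ∀ {xs : List A} → Unique xs → ∀ {i j} → lookup xs i ≡ lookup xs j → i ≡ j
  lookup-injective (_ ∷ _)  {zero}  {zero}  _  = ≡.refl
  lookup-injective (x∉ ∷ _) {zero}  {suc j} eq = contradiction eq (All.lookup x∉ (∈-lookup j))
  lookup-injective (x∉ ∷ _) {suc i} {zero}  eq = contradiction (≡.sym eq) (All.lookup x∉ (∈-lookup i))
  lookup-injective (_ ∷ u)  {suc i} {suc j} eq = cong suc (lookup-injective u eq)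

  -- A piece is cut off only while more than `suc L` elements remain, so every member of `cs` is
  -- full and the remainder `r` is left out of the count. The number `n` is fuel for the recursion.
  cut : ∀ L n (l : List A) → length l ℕ.≤ n → ∃₂ λ cs r →
        l ≡ concat cs ++ r × (∀ {c} → c ∈ cs → length c ℕ.≤ suc L) × length r ℕ.≤ suc L ×
        length cs ℕ.* suc L ℕ.≤ length l
  cut L zero    []      _   = [] , [] , ≡.refl , (λ ()) , ℕ.z≤n , ℕ.z≤n
  cut L (suc n) l l≤n with length l ℕ.≤? suc L
  ... | yes l≤L = [] , l , ≡.refl , (λ ()) , l≤L , ℕ.z≤n
  ... | no  l≰L with cut L n (drop (suc L) l) (begin
          length (drop (suc L) l)  ≡⟨ List.length-drop (suc L) l ⟩
          length l ∸ suc L         ≤⟨ ℕ.∸-monoˡ-≤ (suc L) l≤n ⟩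
          n ∸ L                    ≤⟨ ℕ.m∸n≤m n L ⟩
          n                        ∎)
    where open ℕ.≤-Reasoning
  ...   | cs , r , eq , cs≤ , r≤ , count = take (suc L) l ∷ cs , r
        , ≡.trans (≡.sym (List.take++drop≡id (suc L) l))
            (≡.trans (cong (take (suc L) l ++_) eq) (≡.sym (List.++-assoc (take (suc L) l) (concat cs) r)))
        , (λ { (here ≡.refl) → ℕ.≤-trans (ℕ.≤-reflexive (List.length-take (suc L) l)) (ℕ.m⊓n≤m (suc L) (length l))
             ; (there c∈) → cs≤ c∈ })
        , r≤
        , (begin
          suc L ℕ.+ length cs ℕ.* suc L              ≤⟨ ℕ.+-monoʳ-≤ (suc L) count ⟩
          suc L ℕ.+ length (drop (suc L) l)          ≡⟨ cong (suc L ℕ.+_) (List.length-drop (suc L) l) ⟩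
          suc L ℕ.+ (length l ∸ suc L)               ≡⟨ ℕ.m+[n∸m]≡n (ℕ.<⇒≤ (ℕ.≰⇒> l≰L)) ⟩
          length l                                   ∎)
    where open ℕ.≤-Reasoning

module ListSums (K : OrderedℚAlgebra) where
  open Sums K public

  ∑ : ∀ {A : Set} → (A → Carrier) → List A → Carrier
  ∑ f []       = 0#
  ∑ f (x ∷ xs) = f x + ∑ f xs

  ∑-++ : ∀ {A : Set} (f : A → Carrier) xs ys → ∑ f (xs ++ ys) ≈ ∑ f xs + ∑ f ys
  ∑-++ f []       ys = sym (+-identityˡ (∑ f ys))
  ∑-++ f (x ∷ xs) ys = trans (+-congˡ (∑-++ f xs ys)) (sym (+-assoc (f x) (∑ f xs) (∑ f ys)))

  ∑-↭ : ∀ {A : Set} (f : A → Carrier) {xs ys} → xs ↭ ys → ∑ f xs ≈ ∑ f ys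
  ∑-↭ f ↭refl           = refl
  ∑-↭ f (prep x p)      = +-congˡ (∑-↭ f p)
  ∑-↭ f (↭swap {xs} {ys} x y p) = trans (+-congˡ (+-congˡ (∑-↭ f p)))
    (solve 3 (λ a b c → a :+ (b :+ c) := b :+ (a :+ c)) refl (f x) (f y) (∑ f ys))
    where open Solver
  ∑-↭ f (↭trans p q)    = trans (∑-↭ f p) (∑-↭ f q)

  ∑-tabulate : ∀ {A : Set} (f : A → Carrier) {n} (g : Fin n → A) → ∑ f (List.tabulate g) ≡ sum (f ∘ g)
  ∑-tabulate f {zero}  g = ≡.refl
  ∑-tabulate f {suc n} g = cong (f (g zero) +_) (∑-tabulate f (g ∘ suc))

  ∑-nonNeg : ∀ {A : Set} {f : A → Carrier} → (∀ x → 0# ≤ f x) → ∀ xs → 0# ≤ ∑ f xs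
  ∑-nonNeg 0≤f []       = ≤-refl
  ∑-nonNeg 0≤f (x ∷ xs) = ≤-trans (≤-reflexive (sym (+-identityˡ 0#))) (+-mono-≤ (0≤f x) (∑-nonNeg 0≤f xs))

-- Cauchy-Schwarz for sums over lists

module Inequalities (K : OrderedℚAlgebra) where
  open ListSums K public

  nat : ℕ → Carrier
  nat n = ι (ℤ.+ n ℚ./ 1)

  nat-suc : ∀ n → nat (suc n) ≈ nat n + 1#
  nat-suc n = trans (reflexive (cong ι (suc-/ n 0))) (trans (ι-+ (ℤ.+ n ℚ./ 1) 1ℚ) (+-congˡ ι1≈1))

  0≤nat : ∀ n → 0# ≤ nat n
  0≤nat n = ≤-trans (≤-reflexive (sym ι0≈0)) (ι-mono-≤ (/-nonNeg n 0))

  *-monoʳ-≤ : ∀ {c x y} → 0# ≤ c → x ≤ y → c * x ≤ c * y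
  *-monoʳ-≤ {c} {x} {y} 0≤c x≤y = begin
    c * x                    ≈⟨ +-identityʳ (c * x) ⟨
    c * x + 0#               ≲⟨ +-mono-≤ ≤-refl (0≤x*y 0≤c 0≤y-x) ⟩
    c * x + c * (y - x)      ≈⟨ solve 3 (λ c x y → c :* x :+ c :* (y :- x) := c :* y) refl c x y ⟩
    c * y                    ∎
    where
    open ≤-Reasoning
    open Solver
    0≤y-x : 0# ≤ y - x
    0≤y-x = ≤-trans (≤-reflexive (sym (-‿inverseʳ x))) (+-mono-≤ x≤y ≤-refl)

  *-mono-≤ : ∀ {a b c d} → 0# ≤ b → 0# ≤ c → a ≤ b → c ≤ d → a * c ≤ b * d
  *-mono-≤ {a} {b} {c} {d} 0≤b 0≤c a≤b c≤d = ≤-trans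
    (≤-trans (≤-reflexive (*-comm a c)) (≤-trans (*-monoʳ-≤ 0≤c a≤b) (≤-reflexive (*-comm c b))))
    (*-monoʳ-≤ 0≤b c≤d)

  nat-mono-≤ : ∀ {m n} → m ℕ.≤ n → nat m ≤ nat n
  nat-mono-≤ {_} {n} ℕ.z≤n = ≤-trans (≤-reflexive ι0≈0) (0≤nat n)
  nat-mono-≤ {suc m} {suc n} (ℕ.s≤s m≤n) = ≤-trans (≤-reflexive (nat-suc m))
    (≤-trans (+-mono-≤ (nat-mono-≤ m≤n) ≤-refl) (≤-reflexive (sym (nat-suc n))))

  module _ {A : Set} (f : A → Carrier) where
    ∑-deviation : ∀ z l → ∑ (λ x → (f x - z) * (f x - z)) l ≈
                  ∑ (λ x → f x * f x) l - (z * ∑ f l + z * ∑ f l) + nat (length l) * (z * z)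
    ∑-deviation z [] = sym (begin
      0# - (z * 0# + z * 0#) + nat 0 * (z * z)   ≈⟨ +-cong (+-congˡ (-‿cong (+-cong (zeroʳ z) (zeroʳ z)))) (trans (*-congʳ ι0≈0) (zeroˡ (z * z))) ⟩
      0# - (0# + 0#) + 0#                        ≈⟨ +-identityʳ _ ⟩
      0# - (0# + 0#)                             ≈⟨ +-congˡ (-‿cong (+-identityʳ 0#)) ⟩
      0# - 0#                                    ≈⟨ -‿inverseʳ 0# ⟩
      0#                                         ∎)
      where open ≈-Reasoning
    ∑-deviation z (x ∷ l) = trans (+-congˡ (∑-deviation z l))
      (trans (solve 5 (λ x z q s n → (x :- z) :* (x :- z) :+ (q :- (z :* s :+ z :* s) :+ n :* (z :* z))
                := x :* x :+ q :- (z :* (x :+ s) :+ z :* (x :+ s)) :+ (n :+ con 1ℚ) :* (z :* z)) refl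
                (f x) z (∑ (λ x → f x * f x) l) (∑ f l) (nat (length l)))
             (+-congˡ (*-congʳ (trans (+-congˡ ι1≈1) (sym (nat-suc (length l)))))))
      where open Solver

    -- Prepending `z` raises the difference of the two sides by exactly the sum of the squares of
    -- `f x - f z` over the rest of the list, which `∑-deviation` expands.
    cauchySchwarz : ∀ l → ∑ f l * ∑ f l ≤ nat (length l) * ∑ (λ x → f x * f x) l
    cauchySchwarz [] = ≤-reflexive (trans (zeroˡ 0#) (sym (zeroʳ _)))
    cauchySchwarz (z ∷ l) = begin
      (f z + S) * (f z + S)
        ≈⟨ solve 2 (λ z s → (z :+ s) :* (z :+ s) := s :* s :+ (z :* z :+ (z :* s :+ z :* s))) refl (f z) S ⟩
      S * S + (f z * f z + (f z * S + f z * S))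
        ≲⟨ +-mono-≤ (cauchySchwarz l) ≤-refl ⟩
      n * Q + (f z * f z + (f z * S + f z * S))
        ≈⟨ +-identityʳ _ ⟨
      n * Q + (f z * f z + (f z * S + f z * S)) + 0#
        ≲⟨ +-mono-≤ ≤-refl (∑-nonNeg (λ x → 0≤x² (f x - f z)) l) ⟩
      n * Q + (f z * f z + (f z * S + f z * S)) + ∑ (λ x → (f x - f z) * (f x - f z)) l
        ≈⟨ +-congˡ (∑-deviation (f z) l) ⟩
      n * Q + (f z * f z + (f z * S + f z * S)) + (Q - (f z * S + f z * S) + n * (f z * f z))
        ≈⟨ solve 4 (λ n q z s → n :* q :+ (z :* z :+ (z :* s :+ z :* s)) :+ (q :- (z :* s :+ z :* s) :+ n :* (z :* z))
             := (n :+ con 1ℚ) :* (z :* z :+ q)) refl n Q (f z) S ⟩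
      (n + ι 1ℚ) * (f z * f z + Q)
        ≈⟨ *-congʳ (trans (+-congˡ ι1≈1) (sym (nat-suc (length l)))) ⟩
      nat (suc (length l)) * (f z * f z + Q) ∎
      where
      open ≤-Reasoning
      open Solver
      S = ∑ f l
      Q = ∑ (λ x → f x * f x) l
      n = nat (length l)

-- Walks and spanning forests

module Darts (K : OrderedℚAlgebra) (X : Graph) where
  open Inequalities K public
  open Graph X public

  Dart : Set
  Dart = Fin #E × Bool

  edge : Dart → Fin #E
  edge = proj₁

  reverse : Dart → Dart
  reverse d = proj₁ d , not (proj₂ d)

  src tgt : Dart → Fin #V
  src (e , true)  = v₀ e
  src (e , false) = v₁ e
  tgt (e , true)  = v₁ e
  tgt (e , false) = v₀ e

  tgt-reverse : ∀ d → tgt (reverse d) ≡ src d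
  tgt-reverse (e , true)  = ≡.refl
  tgt-reverse (e , false) = ≡.refl

  src-reverse : ∀ d → src (reverse d) ≡ tgt d
  src-reverse (e , true)  = ≡.refl
  src-reverse (e , false) = ≡.refl

  value : (Fin #E → Carrier) → Dart → Carrier
  value a (e , true)  = a e
  value a (e , false) = - a e

  value-reverse : ∀ a d → value a (reverse d) ≈ - value a d
  value-reverse a (e , true)  = refl
  value-reverse a (e , false) = solve 1 (λ x → x := :- (:- x)) refl (a e)
    where open Solver

  value² : ∀ a d → value a d * value a d ≈ a (edge d) * a (edge d)
  value² a (e , true)  = refl
  value² a (e , false) = solve 1 (λ x → (:- x) :* (:- x) := x :* x) refl (a e)
    where open Solver

  value-cong : ∀ {a b} → (∀ e → a e ≈ b e) → ∀ d → value a d ≈ value b d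
  value-cong a≈b (e , true)  = a≈b e
  value-cong a≈b (e , false) = -‿cong (a≈b e)

  value-linear : ∀ {n} (c : Fin n → Carrier) (b : Fin n → Fin #E → Carrier) d →
                 value (λ e → sum (λ j → c j * b j e)) d ≈ sum (λ j → c j * value (b j) d)
  value-linear c b (e , true)  = refl
  value-linear {n} c b (e , false) = begin
    - sum (λ j → c j * b j e)             ≈⟨ solve 1 (λ s → :- s := con (ℚ.- 1ℚ) :* s) refl (sum (λ j → c j * b j e)) ⟩
    (ι (ℚ.- 1ℚ)) * sum (λ j → c j * b j e)  ≈⟨ *-distribˡ-sum (ι (ℚ.- 1ℚ)) (λ j → c j * b j e) ⟩
    sum (λ j → (ι (ℚ.- 1ℚ)) * (c j * b j e)) ≈⟨ sum-cong-≋ (λ j → solve 2 (λ c b → con (ℚ.- 1ℚ) :* (c :* b) := c :* (:- b)) refl (c j) (b j e)) ⟩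
    sum (λ j → c j * (- b j e))           ∎
    where
    open Solver
    open ≈-Reasoning

  along : (Fin #E → Carrier) → List Dart → Carrier
  along a = ∑ (value a)

  along-cong : ∀ {a b} → (∀ e → a e ≈ b e) → ∀ l → along a l ≈ along b l
  along-cong a≈b []      = refl
  along-cong a≈b (d ∷ l) = +-cong (value-cong a≈b d) (along-cong a≈b l)

  along-linear : ∀ {n} (c : Fin n → Carrier) (b : Fin n → Fin #E → Carrier) l →
                 along (λ e → sum (λ j → c j * b j e)) l ≈ sum (λ j → c j * along (b j) l)
  along-linear c b []      = sym (sum-zero λ j → zeroʳ (c j))
  along-linear c b (d ∷ l) = begin
    value (λ e → sum (λ j → c j * b j e)) d + along (λ e → sum (λ j → c j * b j e)) l
      ≈⟨ +-cong (value-linear c b d) (along-linear c b l) ⟩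
    sum (λ j → c j * value (b j) d) + sum (λ j → c j * along (b j) l)
      ≈⟨ ∑-distrib-+ (λ j → c j * value (b j) d) (λ j → c j * along (b j) l) ⟨
    sum (λ j → c j * value (b j) d + c j * along (b j) l)
      ≈⟨ sum-cong-≋ (λ j → sym (distribˡ (c j) (value (b j) d) (along (b j) l))) ⟩
    sum (λ j → c j * (value (b j) d + along (b j) l)) ∎
    where open ≈-Reasoning

  along-reverse : ∀ a l → along a (map reverse l) ≈ - along a l
  along-reverse a []      = sym -0#≈0#
  along-reverse a (d ∷ l) = trans (+-cong (value-reverse a d) (along-reverse a l))
    (solve 2 (λ x y → (:- x) :+ (:- y) := :- (x :+ y)) refl (value a d) (along a l))
    where open Solver

  coboundary : (Fin #V → Carrier) → Fin #E → Carrier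
  coboundary y e = y (v₁ e) - y (v₀ e)

  value-coboundary : ∀ y d → value (coboundary y) d ≈ y (tgt d) - y (src d)
  value-coboundary y (e , true)  = refl
  value-coboundary y (e , false) = solve 2 (λ u w → :- (u :- w) := w :- u) refl (y (v₁ e)) (y (v₀ e))
    where open Solver

  -- On the tour of a forest, the partial sums are the potentials at the vertices passed.
  visited² : (Fin #E → Carrier) → Carrier → List Dart → Carrier
  visited² a c []      = 0#
  visited² a c (d ∷ l) = (c + value a d) * (c + value a d) + visited² a (c + value a d) l

  visited²-cong : ∀ a {c c′} l → c ≈ c′ → visited² a c l ≈ visited² a c′ l
  visited²-cong a []      c≈c′ = refl
  visited²-cong a (d ∷ l) c≈c′ = +-cong (*-cong c+≈ c+≈) (visited²-cong a l c+≈)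
    where c+≈ = +-congʳ c≈c′

  visited²-++ : ∀ a c p s → visited² a c (p ++ s) ≈ visited² a c p + visited² a (c + along a p) s
  visited²-++ a c []      s = trans (visited²-cong a s (sym (+-identityʳ c))) (sym (+-identityˡ _))
  visited²-++ a c (d ∷ p) s = trans (+-congˡ (trans (visited²-++ a (c + value a d) p s)
    (+-congˡ (visited²-cong a s (+-assoc c (value a d) (along a p))))))
    (sym (+-assoc _ _ _))

  detour-value : ∀ a d x → value a d + (value a (reverse d) + x) ≈ x
  detour-value a d x = trans (+-congˡ (+-congʳ (value-reverse a d)))
    (solve 2 (λ v x → v :+ ((:- v) :+ x) := x) refl (value a d) x)
    where open Solver

  along-detour : ∀ a p d s → along a (p ++ d ∷ reverse d ∷ s) ≈ along a (p ++ s)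
  along-detour a p d s = trans (∑-++ (value a) p (d ∷ reverse d ∷ s))
    (trans (+-congˡ (detour-value a d (along a s))) (sym (∑-++ (value a) p s)))

  -- The detour adds two passed vertices: its far end, with partial sum `z`, and the starting point
  -- once more. The second square is dropped, hence the inequality.
  visited²-detour : ∀ a p d s → let z = along a p + value a d in
    visited² a 0# (p ++ s) + z * z ≤ visited² a 0# (p ++ d ∷ reverse d ∷ s)
  visited²-detour a p d s = begin
    visited² a 0# (p ++ s) + z * z
      ≈⟨ +-congʳ (visited²-++ a 0# p s) ⟩
    (P + visited² a c s) + z * z
      ≈⟨ trans (+-congʳ (sym (+-identityʳ _))) (+-congˡ (*-cong (sym cz) (sym cz))) ⟩
    ((P + visited² a c s) + 0#) + (c + x) * (c + x)
      ≲⟨ +-mono-≤ (+-mono-≤ (≤-reflexive (+-congˡ (visited²-cong a s (sym back)))) (0≤x² c′)) ≤-refl ⟩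
    ((P + visited² a c′ s) + c′ * c′) + (c + x) * (c + x)
      ≈⟨ solve 4 (λ p q u v → ((p :+ q) :+ u) :+ v := p :+ (v :+ (u :+ q))) refl P (visited² a c′ s) (c′ * c′) ((c + x) * (c + x)) ⟩
    P + ((c + x) * (c + x) + (c′ * c′ + visited² a c′ s))
      ≈⟨ visited²-++ a 0# p (d ∷ reverse d ∷ s) ⟨
    visited² a 0# (p ++ d ∷ reverse d ∷ s) ∎
    where
    open ≤-Reasoning
    open Solver
    z = along a p + value a d
    P = visited² a 0# p
    c = 0# + along a p
    x = value a d
    c′ = c + x + value a (reverse d)
    cz : c + x ≈ z
    cz = +-congʳ (+-identityˡ (along a p))
    back : c′ ≈ c
    back = trans (+-congˡ (value-reverse a d)) (solve 2 (λ c x → c :+ x :+ (:- x) := c) refl c x)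

-- Growing a spanning forest together with its tour

module Forests (K : OrderedℚAlgebra) (X : Graph) where
  open Darts K X public

  open DecMembership (Fin._≟_ {#V}) using (_∈?_)

  -- The part of a spanning forest grown so far, the vertices in U being still
  -- untouched.  The closed walks around its components are concatenated into
  -- a single tour, which traverses each forest edge once in each direction.
  record Forest (U : List (Fin #V)) : Set where
    field
      inside outside : List (Fin #E)
      allEdges       : allFin #E ↭ inside ++ outside
      tour           : List Dart
      tourEdges      : map edge tour ↭ inside ++ inside
      tour-closed    : ∀ a → along a tour ≈ 0#
      path           : Fin #V → List Dart
      root           : Fin #V → Fin #V
      path-coboundary : ∀ y v → along (coboundary y) (path v) ≈ y v - y (root v)
      path-inside    : ∀ a → (∀ {e} → e ∈ inside → a e ≈ 0#) → ∀ v → along a (path v) ≈ 0#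
      untouched      : ∀ {v} → v ∈ U → path v ≡ []
      touched        : ∀ d → edge d ∈ inside → tgt d ∉ U
      inside-exact   : ∀ a d → edge d ∈ inside → value a d ≈ along a (path (tgt d)) - along a (path (src d))
      -- A place where a detour to a new neighbour of `v` can be spliced in. Only the partial sum
      -- there has to match the potential of `v`, so the root of a new component, of potential 0,
      -- can use the start of the tour.
      onTour         : ∀ v → ∃₂ λ p s → tour ≡ p ++ s × ∀ a → along a p ≈ along a (path v)
      -- A vertex with nonempty path is passed at least once, possibly more often; the other
      -- vertices have potential 0.
      visited        : ∀ a → sum (λ v → along a (path v) * along a (path v)) ≤ visited² a 0# tour
      sameRoot       : ∀ d → src d ∉ U → tgt d ∉ U → root (src d) ≡ root (tgt d)
      -- Only the component being grown has edges leading to U.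
      frontier       : ∀ d d′ → src d ∉ U → tgt d ∈ U → src d′ ∉ U → tgt d′ ∈ U → root (src d) ≡ root (src d′)

  emptyForest : Forest (allFin #V)
  emptyForest = record
    { inside = [] ; outside = allFin #E ; allEdges = ↭-refl
    ; tour = [] ; tourEdges = ↭-refl ; tour-closed = λ _ → refl
    ; path = λ _ → [] ; root = id
    ; path-coboundary = λ y v → sym (-‿inverseʳ (y v))
    ; path-inside = λ _ _ _ → refl
    ; untouched = λ _ → ≡.refl
    ; touched = λ _ ()
    ; inside-exact = λ _ _ ()
    ; onTour = λ _ → [] , [] , ≡.refl , λ _ → refl
    ; visited = λ a → ≤-reflexive (sum-zero {#V} λ _ → zeroˡ 0#)
    ; sameRoot = λ d src∉ → contradiction (∈-allFin (src d)) src∉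
    ; frontier = λ d _ src∉ → contradiction (∈-allFin (src d)) src∉
    }

  infixl 6 _∖_
  _∖_ : List (Fin #V) → Fin #V → List (Fin #V)
  U ∖ w = filter (λ v → ¬? (v Fin.≟ w)) U

  module _ {U : List (Fin #V)} {w : Fin #V} where
    ∈-∖⁻ : ∀ {v} → v ∈ U ∖ w → v ∈ U × v ≢ w
    ∈-∖⁻ = ∈-filter⁻ (λ v → ¬? (v Fin.≟ w))

    ∉-∖⁻ : ∀ {v} → v ∉ U ∖ w → v ≡ w ⊎ v ∉ U
    ∉-∖⁻ {v} v∉ with v Fin.≟ w
    ... | yes v≡w = inj₁ v≡w
    ... | no  v≢w = inj₂ λ v∈U → v∉ (∈-filter⁺ (λ v → ¬? (v Fin.≟ w)) v∈U v≢w)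

    ∉-∖⁺ : ∀ {v} → v ∉ U → v ∉ U ∖ w
    ∉-∖⁺ v∉U v∈ = v∉U (proj₁ (∈-∖⁻ v∈))

    length-∖ : w ∈ U → length (U ∖ w) ℕ.< length U
    length-∖ w∈U = List.filter-notAll (λ v → ¬? (v Fin.≟ w)) U (lose w∈U λ w≢w → w≢w ≡.refl)

  module _ {U : List (Fin #V)} (F : Forest U) where
    open Forest F

    -- The new root keeps its empty path and the tour is unchanged. Since no edge joined the touched
    -- vertices to `U`, any edge now leading to the untouched part starts at `w`, which gives
    -- `frontier` for the new component.
    newComponent : (∀ d → src d ∉ U → tgt d ∉ U) → ∀ w → w ∈ U → Forest (U ∖ w)
    newComponent closed w w∈U = record
      { inside = inside ; outside = outside ; allEdges = allEdges
      ; tour = tour ; tourEdges = tourEdges ; tour-closed = tour-closed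
      ; path = path ; root = root ; path-coboundary = path-coboundary
      ; path-inside = path-inside
      ; untouched = λ v∈ → untouched (proj₁ (∈-∖⁻ v∈))
      ; touched = λ d e∈ → ∉-∖⁺ (touched d e∈)
      ; inside-exact = inside-exact ; onTour = onTour ; visited = visited
      ; sameRoot = λ d src∉ tgt∉ → sameRoot′ d (∉-∖⁻ src∉) (∉-∖⁻ tgt∉)
      ; frontier = λ d d′ src∉ tgt∈ src′∉ tgt′∈ →
          ≡.trans (atNew d (∉-∖⁻ src∉) (proj₁ (∈-∖⁻ tgt∈))) (≡.sym (atNew d′ (∉-∖⁻ src′∉) (proj₁ (∈-∖⁻ tgt′∈))))
      }
      where
      atNew : ∀ d → src d ≡ w ⊎ src d ∉ U → tgt d ∈ U → root (src d) ≡ root w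
      atNew d (inj₁ src≡w) tgt∈ = cong root src≡w
      atNew d (inj₂ src∉U) tgt∈ = contradiction tgt∈ (closed d src∉U)
      sameRoot′ : ∀ d → src d ≡ w ⊎ src d ∉ U → tgt d ≡ w ⊎ tgt d ∉ U → root (src d) ≡ root (tgt d)
      sameRoot′ d (inj₁ src≡w) (inj₁ tgt≡w) = cong root (≡.trans src≡w (≡.sym tgt≡w))
      sameRoot′ d (inj₁ src≡w) (inj₂ tgt∉U) = contradiction (subst (_∈ U) (≡.sym (≡.trans (tgt-reverse d) src≡w)) w∈U)
        (closed (reverse d) (subst (_∉ U) (≡.sym (src-reverse d)) tgt∉U))
      sameRoot′ d (inj₂ src∉U) (inj₁ tgt≡w) = contradiction (subst (_∈ U) (≡.sym tgt≡w) w∈U) (closed d src∉U)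
      sameRoot′ d (inj₂ src∉U) (inj₂ tgt∉U) = sameRoot d src∉U tgt∉U

    module Attach (d : Dart) (u∉U : src d ∉ U) (w∈U : tgt d ∈ U) where
      u = src d
      w = tgt d
      e = edge d

      path′ : Fin #V → List Dart
      path′ = updateAt path w (const (path u ++ d ∷ []))

      root′ : Fin #V → Fin #V
      root′ = updateAt root w (const (root u))

      path′-w : path′ w ≡ path u ++ d ∷ []
      path′-w = updateAt-updates w path

      path′-≢ : ∀ {v} → v ≢ w → path′ v ≡ path v
      path′-≢ {v} v≢w = updateAt-minimal v w path v≢w

      root′-w : root′ w ≡ root u
      root′-w = updateAt-updates w root

      root′-≢ : ∀ {v} → v ≢ w → root′ v ≡ root v
      root′-≢ {v} v≢w = updateAt-minimal v w root v≢w

      touched⇒≢w : ∀ {v} → v ∉ U → v ≢ w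
      touched⇒≢w v∉U ≡.refl = v∉U w∈U

      new : ∀ a → along a (path u ++ d ∷ []) ≈ along a (path u) + value a d
      new a = trans (∑-++ (value a) (path u) (d ∷ [])) (+-congˡ (+-identityʳ (value a d)))

      along-path′-w : ∀ a → along a (path′ w) ≈ along a (path u) + value a d
      along-path′-w a = trans (reflexive (cong (along a) path′-w)) (new a)

      along-path′-≢ : ∀ a {v} → v ≢ w → along a (path′ v) ≈ along a (path v)
      along-path′-≢ a v≢w = reflexive (cong (along a) (path′-≢ v≢w))

      e∉inside : e ∉ inside
      e∉inside e∈ = touched d e∈ w∈U

      e∈outside : e ∈ outside
      e∈outside with ∈-++⁻ inside (∈-resp-↭ allEdges (∈-allFin e))
      ... | inj₁ e∈inside  = contradiction e∈inside e∉inside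
      ... | inj₂ e∈outside = e∈outside

      before after : List (Fin #E)
      before = proj₁ (∈-∃++ e∈outside)
      after  = proj₁ (proj₂ (∈-∃++ e∈outside))

      outside↭ : outside ↭ e ∷ before ++ after
      outside↭ = ↭-trans (↭-reflexive (proj₂ (proj₂ (∈-∃++ e∈outside)))) (shift e before after)

      p s : List Dart
      p = proj₁ (onTour u)
      s = proj₁ (proj₂ (onTour u))

      tour≡ : tour ≡ p ++ s
      tour≡ = proj₁ (proj₂ (proj₂ (onTour u)))

      p≈ : ∀ a → along a p ≈ along a (path u)
      p≈ = proj₂ (proj₂ (proj₂ (onTour u)))

      -- Going along `d` and straight back keeps the tour closed and uses the new forest edge once
      -- in each direction.
      tour′ : List Dart
      tour′ = p ++ d ∷ reverse d ∷ s

      tourEdges′ : map edge tour′ ↭ (e ∷ inside) ++ (e ∷ inside)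
      tourEdges′ = ↭-trans (↭-reflexive (List.map-++ edge p (d ∷ reverse d ∷ s)))
        (↭-trans (shift e (map edge p) (e ∷ map edge s))
        (prep e (↭-trans (shift e (map edge p) (map edge s))
        (↭-trans (prep e (↭-trans (↭-reflexive (≡.trans (≡.sym (List.map-++ edge p s)) (cong (map edge) (≡.sym tour≡)))) tourEdges))
        (↭-sym (shift e inside inside))))))

      -- A prefix ending before the detour survives as it is; a longer one absorbs `d` and
      -- `reverse d`, whose values cancel.
      onTour′-≢ : ∀ v → ∃₂ λ p₁ s₁ → tour′ ≡ p₁ ++ s₁ × ∀ a → along a p₁ ≈ along a (path v)
      onTour′-≢ v with onTour v
      ... | p₁ , s₁ , tour≡₁ , p₁≈ with ++-splits p₁ s₁ p s (≡.trans (≡.sym tour≡₁) tour≡)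
      ...   | inj₁ (r , p≡ , _) = p₁ , r ++ d ∷ reverse d ∷ s
                , ≡.trans (cong (_++ d ∷ reverse d ∷ s) p≡) (List.++-assoc p₁ r (d ∷ reverse d ∷ s)) , p₁≈
      ...   | inj₂ (r , p₁≡ , s≡) = p ++ d ∷ reverse d ∷ r , s₁
                , ≡.trans (cong (λ z → p ++ d ∷ reverse d ∷ z) s≡) (≡.sym (List.++-assoc p (d ∷ reverse d ∷ r) s₁))
                , λ a → trans (along-detour a p d r) (trans (reflexive (cong (along a) (≡.sym p₁≡))) (p₁≈ a))

      onTour′ : ∀ v → ∃₂ λ p₁ s₁ → tour′ ≡ p₁ ++ s₁ × ∀ a → along a p₁ ≈ along a (path′ v)
      onTour′ v with v Fin.≟ w
      ... | no v≢w = let p₁ , s₁ , eq , p₁≈ = onTour′-≢ v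
                     in p₁ , s₁ , eq , λ a → trans (p₁≈ a) (sym (along-path′-≢ a v≢w))
      ... | yes ≡.refl = p ++ d ∷ [] , reverse d ∷ s , ≡.sym (List.++-assoc p (d ∷ []) (reverse d ∷ s))
                , λ a → trans (∑-++ (value a) p (d ∷ [])) (trans (+-cong (p≈ a) (+-identityʳ (value a d))) (sym (along-path′-w a)))

      -- Only the potential of `w` changes, from 0 (its path was empty) to `z`, and the detour
      -- supplies the square of `z` on the right.
      visited′ : ∀ a → sum (λ v → along a (path′ v) * along a (path′ v)) ≤ visited² a 0# tour′
      visited′ a = begin
        sum (λ v → along a (path′ v) * along a (path′ v))
          ≈⟨ sum-cong-≋ split ⟩
        sum (λ v → along a (path v) * along a (path v) + at v)
          ≈⟨ ∑-distrib-+ (λ v → along a (path v) * along a (path v)) at ⟩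
        sum (λ v → along a (path v) * along a (path v)) + sum at
          ≈⟨ +-congˡ (trans (sum-select w at λ v v≢w → reflexive (updateAt-minimal v w (λ _ → 0#) v≢w))
               (reflexive (updateAt-updates w (λ _ → 0#)))) ⟩
        sum (λ v → along a (path v) * along a (path v)) + z * z
          ≲⟨ +-mono-≤ (visited a) ≤-refl ⟩
        visited² a 0# tour + z * z
          ≈⟨ +-congʳ (reflexive (cong (visited² a 0#) tour≡)) ⟩
        visited² a 0# (p ++ s) + z * z
          ≲⟨ visited²-detour a p d s ⟩
        visited² a 0# tour′ ∎
        where
        open ≤-Reasoning
        z = along a p + value a d
        at : Fin #V → Carrier
        at = updateAt (λ _ → 0#) w (const (z * z))
        split : ∀ v → along a (path′ v) * along a (path′ v) ≈ along a (path v) * along a (path v) + at v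
        split v with v Fin.≟ w
        ... | no v≢w = trans (*-cong (along-path′-≢ a v≢w) (along-path′-≢ a v≢w))
              (trans (sym (+-identityʳ _)) (+-congˡ (reflexive (≡.sym (updateAt-minimal v w (λ _ → 0#) v≢w)))))
        ... | yes ≡.refl = trans (*-cong eq eq) (trans (sym (+-identityˡ (z * z)))
              (+-cong (sym (trans (*-congʳ old) (zeroˡ _))) (reflexive (≡.sym (updateAt-updates w (λ _ → 0#))))))
          where
          eq : along a (path′ w) ≈ z
          eq = trans (along-path′-w a) (+-congʳ (sym (p≈ a)))
          old : along a (path w) ≈ 0#
          old = reflexive (cong (along a) (untouched w∈U))

      path-coboundary′ : ∀ y v → along (coboundary y) (path′ v) ≈ y v - y (root′ v)
      path-coboundary′ y v with v Fin.≟ w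
      ... | no v≢w = trans (along-path′-≢ (coboundary y) v≢w)
            (trans (path-coboundary y v) (+-congˡ (-‿cong (reflexive (cong y (≡.sym (root′-≢ v≢w)))))))
      ... | yes ≡.refl = trans (along-path′-w (coboundary y))
            (trans (+-cong (path-coboundary y u) (value-coboundary y d))
            (trans (solve 3 (λ a b c → (a :- b) :+ (c :- a) := c :- b) refl (y u) (y (root u)) (y w))
            (+-congˡ (-‿cong (reflexive (cong y (≡.sym root′-w)))))))
        where open Solver

      inside-exact-d : ∀ a → value a d ≈ along a (path′ w) - along a (path′ u)
      inside-exact-d a = trans (solve 2 (λ x y → y := x :+ y :- x) refl (along a (path u)) (value a d))
        (+-cong (sym (along-path′-w a)) (-‿cong (sym (along-path′-≢ a (touched⇒≢w u∉U)))))
        where open Solver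

      inside-exact′ : ∀ a d₁ → edge d₁ ∈ e ∷ inside →
                      value a d₁ ≈ along a (path′ (tgt d₁)) - along a (path′ (src d₁))
      inside-exact′ a d₁ (there e∈) = trans (inside-exact a d₁ e∈)
        (sym (+-cong (along-path′-≢ a (touched⇒≢w (touched d₁ e∈)))
          (-‿cong (along-path′-≢ a (touched⇒≢w (subst (_∉ U) (tgt-reverse d₁) (touched (reverse d₁) e∈)))))))
      -- Here `d₁` is `d` or its reverse. Splitting on both directions lets the endpoints and values
      -- reduce; if the directions differ, both sides change sign.
      inside-exact′ a d₁ (here e≡) = orient (proj₂ d) (proj₂ d₁) e≡ (inside-exact-d a)
        where
        open Solver
        flip : ∀ {x y z} → x ≈ y - z → - x ≈ z - y
        flip {x} {y} {z} x≈ = trans (-‿cong x≈) (solve 2 (λ y z → :- (y :- z) := z :- y) refl y z)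
        unflip : ∀ {x y z} → - x ≈ y - z → x ≈ z - y
        unflip {x} -x≈ = trans (solve 1 (λ x → x := :- (:- x)) refl x) (flip -x≈)
        Exact : Dart → Set
        Exact d = value a d ≈ along a (path′ (tgt d)) - along a (path′ (src d))
        orient : ∀ b b₁ → proj₁ d₁ ≡ e → Exact (e , b) → Exact (proj₁ d₁ , b₁)
        orient true  true  ≡.refl eq = eq
        orient true  false ≡.refl eq = flip eq
        orient false true  ≡.refl eq = unflip eq
        orient false false ≡.refl eq = eq

      w∉ : w ∉ U ∖ w
      w∉ w∈ = proj₂ (∈-∖⁻ {U} w∈) ≡.refl

      touched′ : ∀ d₁ → edge d₁ ∈ e ∷ inside → tgt d₁ ∉ U ∖ w
      touched′ d₁ (there e∈) = ∉-∖⁺ (touched d₁ e∈)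
      touched′ d₁ (here e≡)  = orient (proj₂ d) (proj₂ d₁) e≡ w∉ (∉-∖⁺ u∉U)
        where
        orient : ∀ b b₁ → proj₁ d₁ ≡ e → tgt (e , b) ∉ U ∖ w → src (e , b) ∉ U ∖ w → tgt (proj₁ d₁ , b₁) ∉ U ∖ w
        orient true  true  ≡.refl t _ = t
        orient true  false ≡.refl _ s = s
        orient false true  ≡.refl _ s = s
        orient false false ≡.refl t _ = t

      -- Before the attachment `d` itself led to `U`, so `frontier` puts the source of every other
      -- such edge into the component of `u`. This also covers the edges from older vertices to `w`,
      -- the ones that close cycles, and thereby yields `sameRoot′`.
      root′-frontier : ∀ d₁ → src d₁ ≡ w ⊎ src d₁ ∉ U → tgt d₁ ∈ U → root′ (src d₁) ≡ root u
      root′-frontier d₁ (inj₁ src≡w) tgt∈U = ≡.trans (cong root′ src≡w) root′-w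
      root′-frontier d₁ (inj₂ src∉U) tgt∈U = ≡.trans (root′-≢ (touched⇒≢w src∉U)) (frontier d₁ d src∉U tgt∈U u∉U w∈U)

      sameRoot′ : ∀ d₁ → src d₁ ≡ w ⊎ src d₁ ∉ U → tgt d₁ ≡ w ⊎ tgt d₁ ∉ U → root′ (src d₁) ≡ root′ (tgt d₁)
      sameRoot′ d₁ (inj₁ src≡w) (inj₁ tgt≡w) = cong root′ (≡.trans src≡w (≡.sym tgt≡w))
      sameRoot′ d₁ (inj₁ src≡w) (inj₂ tgt∉U) = ≡.trans (≡.trans (cong root′ src≡w) root′-w)
        (≡.trans (≡.sym (root′-frontier (reverse d₁) (inj₂ (subst (_∉ U) (≡.sym (src-reverse d₁)) tgt∉U))
          (subst (_∈ U) (≡.sym (≡.trans (tgt-reverse d₁) src≡w)) w∈U)))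
        (cong root′ (src-reverse d₁)))
      sameRoot′ d₁ (inj₂ src∉U) (inj₁ tgt≡w) = ≡.trans
        (root′-frontier d₁ (inj₂ src∉U) (subst (_∈ U) (≡.sym tgt≡w) w∈U))
        (≡.sym (≡.trans (cong root′ tgt≡w) root′-w))
      sameRoot′ d₁ (inj₂ src∉U) (inj₂ tgt∉U) = ≡.trans (root′-≢ (touched⇒≢w src∉U))
        (≡.trans (sameRoot d₁ src∉U tgt∉U) (≡.sym (root′-≢ (touched⇒≢w tgt∉U))))

      path-inside′ : ∀ a → (∀ {e₁} → e₁ ∈ e ∷ inside → a e₁ ≈ 0#) → ∀ v → along a (path′ v) ≈ 0#
      path-inside′ a a≈0 v with v Fin.≟ w
      ... | no v≢w = trans (along-path′-≢ a v≢w) (path-inside a (a≈0 ∘ there) v)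
      ... | yes ≡.refl = trans (along-path′-w a)
            (trans (+-cong (path-inside a (a≈0 ∘ there) u) (vanish d (a≈0 (here ≡.refl)))) (+-identityʳ 0#))
        where
        vanish : ∀ d → a (edge d) ≈ 0# → value a d ≈ 0#
        vanish (e , true)  a≈0 = a≈0
        vanish (e , false) a≈0 = trans (-‿cong a≈0) -0#≈0#

      attach : Forest (U ∖ w)
      attach = record
        { inside = e ∷ inside ; outside = before ++ after
        ; allEdges = ↭-trans allEdges (↭-trans (++⁺ˡ inside outside↭) (shift e inside (before ++ after)))
        ; tour = tour′ ; tourEdges = tourEdges′
        ; tour-closed = λ a → trans (along-detour a p d s)
            (trans (reflexive (cong (along a) (≡.sym tour≡))) (tour-closed a))
        ; path = path′ ; root = root′ ; path-coboundary = path-coboundary′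
        ; path-inside = path-inside′
        ; untouched = λ v∈ → ≡.trans (path′-≢ (proj₂ (∈-∖⁻ {U} v∈))) (untouched (proj₁ (∈-∖⁻ {U} v∈)))
        ; touched = touched′ ; inside-exact = inside-exact′ ; onTour = onTour′ ; visited = visited′
        ; sameRoot = λ d₁ src∉ tgt∉ → sameRoot′ d₁ (∉-∖⁻ src∉) (∉-∖⁻ tgt∉)
        ; frontier = λ d₁ d₂ src∉ tgt∈ src₂∉ tgt₂∈ →
            ≡.trans (root′-frontier d₁ (∉-∖⁻ src∉) (proj₁ (∈-∖⁻ tgt∈)))
              (≡.sym (root′-frontier d₂ (∉-∖⁻ src₂∉) (proj₁ (∈-∖⁻ tgt₂∈))))
        }

  crossing? : ∀ U → Dec (∃ λ d → src d ∉ U × tgt d ∈ U)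
  crossing? U = map′ to from (Fin.any? λ e → cross? (e , true) ⊎-dec cross? (e , false))
    where
    Cross : Dart → Set
    Cross d = src d ∉ U × tgt d ∈ U
    cross? : ∀ d → Dec (Cross d)
    cross? d = ¬? (src d ∈? U) ×-dec (tgt d ∈? U)
    to : (∃ λ e → Cross (e , true) ⊎ Cross (e , false)) → ∃ Cross
    to (e , inj₁ c) = (e , true) , c
    to (e , inj₂ c) = (e , false) , c
    from : ∃ Cross → ∃ λ e → Cross (e , true) ⊎ Cross (e , false)
    from ((e , true)  , c) = e , inj₁ c
    from ((e , false) , c) = e , inj₂ c

  -- A new component is begun only when no edge extends the current one, as `newComponent` demands.
  -- Either step removes a vertex from `U`, so the bound `n` on its length serves as fuel.
  grow : ∀ n U → length U ℕ.≤ n → Forest U → Forest []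
  grow n       []         U≤n         F = F
  grow (suc n) U@(w ∷ _) U≤n F with crossing? U
  ... | yes (d , u∉U , w∈U) = grow n (U ∖ tgt d) (ℕ.≤-pred (ℕ.≤-trans (length-∖ {U} w∈U) U≤n))
          (Attach.attach F d u∉U w∈U)
  ... | no ¬crossing = grow n (U ∖ w) (ℕ.≤-pred (ℕ.≤-trans (length-∖ {U} {w} (here ≡.refl)) U≤n))
          (newComponent F (λ d src∉ tgt∈ → ¬crossing (d , src∉ , tgt∈)) w (here ≡.refl))

  spanningForest : Forest []
  spanningForest = grow (length (allFin #V)) (allFin #V) ℕ.≤-refl emptyForest

-- Potentials and cycles

module Poincaré (K : OrderedℚAlgebra) (X : Graph) where
  open Forests K X public

  energy : (Fin #E → Carrier) → List Dart → Carrier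
  energy a = ∑ (λ d → a (edge d) * a (edge d))

  energy-reverse : ∀ a l → energy a (map reverse l) ≈ energy a l
  energy-reverse a []      = refl
  energy-reverse a (d ∷ l) = +-congˡ (energy-reverse a l)

  energy≈∑value² : ∀ a l → ∑ (λ d → value a d * value a d) l ≈ energy a l
  energy≈∑value² a []      = refl
  energy≈∑value² a (d ∷ l) = +-cong (value² a d) (energy≈∑value² a l)

  0≤energy : ∀ a l → 0# ≤ energy a l
  0≤energy a = ∑-nonNeg λ d → 0≤x² (a (edge d))

  -- On a walk with vanishing sum, twice a partial sum is the sum over the walk
  -- with the remaining part reversed.
  partialSum-≤ : ∀ a p s → along a (p ++ s) ≈ 0# →
    nat 4 * (along a p * along a p) ≤ nat (length (p ++ s)) * energy a (p ++ s)
  partialSum-≤ a p s closed = begin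
    nat 4 * (σ * σ)
      ≈⟨ solve 1 (λ σ → con (ℤ.+ 4 ℚ./ 1) :* (σ :* σ) := (σ :+ σ) :* (σ :+ σ)) refl σ ⟩
    (σ + σ) * (σ + σ)
      ≈⟨ *-cong σ+σ≈ σ+σ≈ ⟩
    along a q * along a q
      ≲⟨ cauchySchwarz (value a) q ⟩
    nat (length q) * ∑ (λ d → value a d * value a d) q
      ≈⟨ *-cong (reflexive (cong nat same-length)) (trans (energy≈∑value² a q) same-energy) ⟩
    nat (length (p ++ s)) * energy a (p ++ s) ∎
    where
    open ≤-Reasoning
    open Solver
    σ = along a p
    q = p ++ map reverse s
    τ≈ : σ ≈ - along a s
    τ≈ = trans (solve 2 (λ x y → x := x :+ y :- y) refl σ (along a s))
      (trans (+-congʳ (trans (sym (∑-++ (value a) p s)) closed)) (+-identityˡ _))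
    σ+σ≈ : σ + σ ≈ along a q
    σ+σ≈ = trans (+-congˡ (trans τ≈ (sym (along-reverse a s)))) (sym (∑-++ (value a) p (map reverse s)))
    same-length : length q ≡ length (p ++ s)
    same-length = ≡.trans (List.length-++ p) (≡.trans (cong (length p ℕ.+_) (List.length-map reverse s)) (≡.sym (List.length-++ p)))
    same-energy : energy a q ≈ energy a (p ++ s)
    same-energy = trans (∑-++ _ p (map reverse s)) (trans (+-congˡ (energy-reverse a s)) (sym (∑-++ _ p s)))

  -- Each partial sum is bounded by `partialSum-≤`, except the last one: it is the sum over all of
  -- `l`, hence zero. This saves one term and produces `length s ∸ 1`, the source of the factor M-1
  -- in place of M.
  visited²-≤-step : ∀ a l → along a l ≈ 0# → ∀ p s → l ≡ p ++ s → ∀ c → c ≈ along a p →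
    nat 4 * visited² a c s ≤ nat (length s ∸ 1) * (nat (length l) * energy a l)
  visited²-≤-step a l closed p [] l≡ c c≈ =
    ≤-reflexive (trans (zeroʳ _) (sym (trans (*-congʳ ι0≈0) (zeroˡ _))))
  visited²-≤-step a l closed p (d ∷ []) l≡ c c≈ =
    ≤-reflexive (trans (*-congˡ (trans (+-identityʳ _) (trans (*-congʳ z≈0) (zeroˡ _))))
      (trans (zeroʳ _) (sym (trans (*-congʳ ι0≈0) (zeroˡ _)))))
    where
    z≈0 : c + value a d ≈ 0#
    z≈0 = trans (+-cong c≈ (sym (+-identityʳ (value a d))))
      (trans (sym (∑-++ (value a) p (d ∷ []))) (trans (reflexive (cong (along a) (≡.sym l≡))) closed))
  visited²-≤-step a l closed p (d ∷ s@(_ ∷ s′)) l≡ c c≈ = begin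
    nat 4 * (z * z + visited² a z s)
      ≈⟨ distribˡ (nat 4) (z * z) (visited² a z s) ⟩
    nat 4 * (z * z) + nat 4 * visited² a z s
      ≲⟨ +-mono-≤ bound (visited²-≤-step a l closed (p ++ d ∷ []) s l≡′ z z≈) ⟩
    M + nat (length s′) * M
      ≈⟨ solve 2 (λ m n → m :+ n :* m := (n :+ con 1ℚ) :* m) refl M (nat (length s′)) ⟩
    (nat (length s′) + ι 1ℚ) * M
      ≈⟨ *-congʳ (trans (+-congˡ ι1≈1) (sym (nat-suc (length s′)))) ⟩
    nat (suc (length s′)) * M ∎
    where
    open ≤-Reasoning
    open Solver
    M = nat (length l) * energy a l
    z = c + value a d
    l≡′ : l ≡ (p ++ d ∷ []) ++ s
    l≡′ = ≡.trans l≡ (≡.sym (List.++-assoc p (d ∷ []) s))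
    z≈ : z ≈ along a (p ++ d ∷ [])
    z≈ = trans (+-cong c≈ (sym (+-identityʳ (value a d)))) (sym (∑-++ (value a) p (d ∷ [])))
    bound : nat 4 * (z * z) ≤ M
    bound = ≤-trans (≤-reflexive (*-congˡ (*-cong z≈ z≈)))
      (subst (λ l → nat 4 * (along a (p ++ d ∷ []) * along a (p ++ d ∷ [])) ≤ nat (length l) * energy a l)
        (≡.sym l≡′) (partialSum-≤ a (p ++ d ∷ []) s (trans (reflexive (cong (along a) (≡.sym l≡′))) closed)))

  visited²-≤ : ∀ a L l → length l ℕ.≤ suc L → along a l ≈ 0# →
               nat 4 * visited² a 0# l ≤ nat L * nat (suc L) * energy a l
  visited²-≤ a L l l≤ closed = begin
    nat 4 * visited² a 0# l
      ≲⟨ visited²-≤-step a l closed [] l ≡.refl 0# refl ⟩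
    nat (length l ∸ 1) * (nat (length l) * energy a l)
      ≲⟨ *-mono-≤ (0≤nat L) (0≤x*y (0≤nat (length l)) (0≤energy a l)) (nat-mono-≤ (ℕ.∸-monoˡ-≤ 1 l≤))
           (*-mono-≤ (0≤nat (suc L)) (0≤energy a l) (nat-mono-≤ l≤) ≤-refl) ⟩
    nat L * (nat (suc L) * energy a l)
      ≈⟨ *-assoc _ _ _ ⟨
    nat L * nat (suc L) * energy a l ∎
    where open ≤-Reasoning

  -- A piece with vanishing sum hands the partial sum 0 on to the next one, so the pieces can be
  -- estimated separately and the bounds added.
  visited²-concat-≤ : ∀ a L cs r → (∀ {c} → c ∈ cs → length c ℕ.≤ suc L) → length r ℕ.≤ suc L →
    (∀ {c} → c ∈ cs → along a c ≈ 0#) → along a r ≈ 0# →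
    nat 4 * visited² a 0# (concat cs ++ r) ≤ nat L * nat (suc L) * energy a (concat cs ++ r)
  visited²-concat-≤ a L []       r cs≤ r≤ cs≈0 r≈0 = visited²-≤ a L r r≤ r≈0
  visited²-concat-≤ a L (c ∷ cs) r cs≤ r≤ cs≈0 r≈0 = begin
    nat 4 * visited² a 0# ((c ++ concat cs) ++ r)
      ≈⟨ *-congˡ (reflexive (cong (visited² a 0#) (List.++-assoc c (concat cs) r))) ⟩
    nat 4 * visited² a 0# (c ++ t)
      ≈⟨ *-congˡ (trans (visited²-++ a 0# c t) (+-congˡ (visited²-cong a t (trans (+-identityˡ _) (cs≈0 (here ≡.refl)))))) ⟩
    nat 4 * (visited² a 0# c + visited² a 0# t)
      ≈⟨ distribˡ _ _ _ ⟩
    nat 4 * visited² a 0# c + nat 4 * visited² a 0# t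
      ≲⟨ +-mono-≤ (visited²-≤ a L c (cs≤ (here ≡.refl)) (cs≈0 (here ≡.refl)))
                  (visited²-concat-≤ a L cs r (cs≤ ∘ there) r≤ (cs≈0 ∘ there) r≈0) ⟩
    κ * energy a c + κ * energy a t
      ≈⟨ distribˡ _ _ _ ⟨
    κ * (energy a c + energy a t)
      ≈⟨ *-congˡ (trans (sym (∑-++ _ c t)) (reflexive (cong (energy a) (≡.sym (List.++-assoc c (concat cs) r))))) ⟩
    κ * energy a ((c ++ concat cs) ++ r) ∎
    where
    open ≤-Reasoning
    t = concat cs ++ r
    κ = nat L * nat (suc L)

-- Fundamental cycles, the kernel, and the dimension bound

module KernelAndRank (K : OrderedℚAlgebra) (X : Graph) where
  open Poincaré K X public
  open Forest spanningForest public

  potential : (Fin #E → Carrier) → Fin #V → Carrier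
  potential a v = along a (path v)

  -- The fundamental cycle of `e` up to the order of its darts: `map reverse` turns each dart around
  -- but does not reverse the list, a difference that sums do not see.
  cycle : Fin #E → List Dart
  cycle e = (e , true) ∷ map reverse (path (v₁ e)) ++ path (v₀ e)

  along-cycle : ∀ a e → along a (cycle e) ≈ a e - coboundary (potential a) e
  along-cycle a e = trans
    (+-congˡ (trans (∑-++ (value a) (map reverse (path (v₁ e))) (path (v₀ e))) (+-congʳ (along-reverse a (path (v₁ e))))))
    (solve 3 (λ a y x → a :+ ((:- y) :+ x) := a :- (y :- x)) refl (a e) (potential a (v₁ e)) (potential a (v₀ e)))
    where open Solver

  -- On forest edges this is `inside-exact`; on any other edge the difference of the two sides is
  -- the sum of `a` along the fundamental cycle.
  exact : ∀ a → (∀ {e} → e ∈ outside → along a (cycle e) ≈ 0#) → ∀ e → a e ≈ coboundary (potential a) e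
  exact a cycles≈0 e with ∈-++⁻ inside (∈-resp-↭ allEdges (∈-allFin e))
  ... | inj₁ e∈inside  = inside-exact a (e , true) e∈inside
  ... | inj₂ e∈outside = begin
    a e                                    ≈⟨ solve 2 (λ a x → a := (a :- x) :+ x) refl (a e) x ⟩
    (a e - x) + x                          ≈⟨ +-congʳ (trans (sym (along-cycle a e)) (cycles≈0 e∈outside)) ⟩
    0# + x                                 ≈⟨ +-identityˡ x ⟩
    x                                      ∎
    where
    open ≈-Reasoning
    open Solver
    x = coboundary (potential a) e

  -- By `path-coboundary` everything cancels except the values of `y` at the roots of the two
  -- endpoints, and these roots agree by `sameRoot`, no vertex being untouched any more.
  cycle-closed : ∀ y e → along (coboundary y) (cycle e) ≈ 0#
  cycle-closed y e = begin
    along (coboundary y) (cycle e)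
      ≈⟨ along-cycle (coboundary y) e ⟩
    (y (v₁ e) - y (v₀ e)) - (potential (coboundary y) (v₁ e) - potential (coboundary y) (v₀ e))
      ≈⟨ +-congˡ (-‿cong (+-cong (path-coboundary y (v₁ e)) (-‿cong (path-coboundary y (v₀ e))))) ⟩
    (y (v₁ e) - y (v₀ e)) - ((y (v₁ e) - y (root (v₁ e))) - (y (v₀ e) - y (root (v₀ e))))
      ≈⟨ solve 4 (λ b a s r → (b :- a) :- ((b :- s) :- (a :- r)) := s :- r) refl (y (v₁ e)) (y (v₀ e)) (y (root (v₁ e))) (y (root (v₀ e))) ⟩
    y (root (v₁ e)) - y (root (v₀ e))
      ≈⟨ +-congʳ (reflexive (cong y (≡.sym (sameRoot (e , true) (λ ()) (λ ()))))) ⟩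
    y (root (v₀ e)) - y (root (v₀ e))
      ≈⟨ -‿inverseʳ _ ⟩
    0# ∎
    where
    open ≈-Reasoning
    open Solver

  unit : ∀ {n} → Fin n → Fin n → Carrier
  unit i j = if does (i Fin.≟ j) then 1# else 0#

  unit-≡ : ∀ {n} (i : Fin n) → unit i i ≈ 1#
  unit-≡ i = reflexive (cong (if_then 1# else 0#) (dec-true (i Fin.≟ i) ≡.refl))

  unit-≢ : ∀ {n} {i j : Fin n} → i ≢ j → unit i j ≈ 0#
  unit-≢ {i = i} {j} i≢j = reflexive (cong (if_then 1# else 0#) (dec-false (i Fin.≟ j) i≢j))

  sum-unit : ∀ {n} (f : Fin n → Carrier) i → sum (λ j → f j * unit j i) ≈ f i
  sum-unit f i = trans (sum-select i (λ j → f j * unit j i) λ j j≢i → trans (*-congˡ (unit-≢ j≢i)) (zeroʳ (f j)))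
    (trans (*-congˡ (unit-≡ i)) (*-identityʳ (f i)))

  -- Over the reals this reduces to `c₁ X`, so results about it apply there without any transport.
  boundary : (Fin #E → Carrier) → Fin #V → Carrier
  boundary a v = sum (λ e → if does (v₁ e Fin.≟ v) then a e else 0#)
               - sum (λ e → if does (v₀ e Fin.≟ v) then a e else 0#)

  sum-endpoint : ∀ (y : Fin #V → Carrier) (a : Fin #E → Carrier) (end : Fin #E → Fin #V) →
    sum (λ v → y v * sum (λ e → if does (end e Fin.≟ v) then a e else 0#)) ≈ sum (λ e → a e * y (end e))
  sum-endpoint y a end = begin
    sum (λ v → y v * sum (λ e → at e v))
      ≈⟨ sum-cong-≋ (λ v → *-distribˡ-sum (y v) (λ e → at e v)) ⟩
    sum (λ v → sum (λ e → y v * at e v))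
      ≈⟨ ∑-comm (λ v e → y v * at e v) ⟩
    sum (λ e → sum (λ v → y v * at e v))
      ≈⟨ sum-cong-≋ (λ e → trans
           (sum-select (end e) (λ v → y v * at e v) λ v v≢ → trans (*-congˡ (at-≢ e v v≢)) (zeroʳ (y v)))
           (trans (*-congˡ (at-≡ e)) (*-comm (y (end e)) (a e)))) ⟩
    sum (λ e → a e * y (end e)) ∎
    where
    open ≈-Reasoning
    at : Fin #E → Fin #V → Carrier
    at e v = if does (end e Fin.≟ v) then a e else 0#
    at-≡ : ∀ e → at e (end e) ≈ a e
    at-≡ e = reflexive (cong (if_then a e else 0#) (dec-true (end e Fin.≟ end e) ≡.refl))
    at-≢ : ∀ e v → v ≢ end e → at e v ≈ 0#
    at-≢ e v v≢ = reflexive (cong (if_then a e else 0#) (dec-false (end e Fin.≟ v) (v≢ ∘ ≡.sym)))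

  sum-difference : ∀ {n} (f g : Fin n → Carrier) → sum (λ i → f i - g i) ≈ sum f - sum g
  sum-difference f g = begin
    sum (λ i → f i - g i)
      ≈⟨ sum-cong-≋ (λ i → solve 2 (λ f g → f :- g := con 1ℚ :* f :+ con (ℚ.- 1ℚ) :* g) refl (f i) (g i)) ⟩
    sum (λ i → ι 1ℚ * f i + ι (ℚ.- 1ℚ) * g i)
      ≈⟨ sum-linear (ι 1ℚ) (ι (ℚ.- 1ℚ)) f g ⟩
    ι 1ℚ * sum f + ι (ℚ.- 1ℚ) * sum g
      ≈⟨ solve 2 (λ f g → con 1ℚ :* f :+ con (ℚ.- 1ℚ) :* g := f :- g) refl (sum f) (sum g) ⟩
    sum f - sum g ∎
    where
    open ≈-Reasoning
    open Solver

  adjoint : ∀ (y : Fin #V → Carrier) (a : Fin #E → Carrier) → sum (λ v → y v * boundary a v) ≈ sum (λ e → a e * coboundary y e)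
  adjoint y a = begin
    sum (λ v → y v * boundary a v)
      ≈⟨ sum-cong-≋ (λ v → distrib- (y v) _ _) ⟩
    sum (λ v → y v * sum (λ e → at v₁ e v) - y v * sum (λ e → at v₀ e v))
      ≈⟨ sum-difference (λ v → y v * sum (λ e → at v₁ e v)) (λ v → y v * sum (λ e → at v₀ e v)) ⟩
    sum (λ v → y v * sum (λ e → at v₁ e v)) - sum (λ v → y v * sum (λ e → at v₀ e v))
      ≈⟨ +-cong (sum-endpoint y a v₁) (-‿cong (sum-endpoint y a v₀)) ⟩
    sum (λ e → a e * y (v₁ e)) - sum (λ e → a e * y (v₀ e))
      ≈⟨ sum-difference (λ e → a e * y (v₁ e)) (λ e → a e * y (v₀ e)) ⟨
    sum (λ e → a e * y (v₁ e) - a e * y (v₀ e))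
      ≈⟨ sum-cong-≋ (λ e → sym (distrib- (a e) _ _)) ⟩
    sum (λ e → a e * coboundary y e) ∎
    where
    open ≈-Reasoning
    at : (Fin #E → Fin #V) → Fin #E → Fin #V → Carrier
    at end e v = if does (end e Fin.≟ v) then a e else 0#
    distrib- : ∀ x y z → x * (y - z) ≈ x * y - x * z
    distrib- = solve 3 (λ x y z → x :* (y :- z) := x :* y :- x :* z) refl
      where open Solver

  -- The 1-chain of `l`: the net number of times that `l` traverses `e`.
  indicator : List Dart → Fin #E → Carrier
  indicator l e = along (unit e) l

  sum-indicator : ∀ l a → sum (λ e → a e * indicator l e) ≈ along a l
  sum-indicator l a = trans (sym (along-linear a unit l)) (along-cong (sum-unit a) l)

  cycleVector : Fin (length outside) → Fin #E → Carrier
  cycleVector j = indicator (cycle (lookup outside j))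

  -- By duality: the component at `v` pairs `a` with the coboundary of the unit function at `v`, and
  -- coboundaries sum to zero along cycles. No count of the darts entering and leaving a vertex is
  -- involved.
  boundary-cycles : ∀ (c : Fin (length outside) → Carrier) a → (∀ e → a e ≈ sum (λ j → c j * cycleVector j e)) → ∀ v → boundary a v ≈ 0#
  boundary-cycles c a a≈ v = begin
    boundary a v
      ≈⟨ sum-unit (boundary a) v ⟨
    sum (λ u → boundary a u * unit u v)
      ≈⟨ sum-cong-≋ (λ u → *-comm (boundary a u) (unit u v)) ⟩
    sum (λ u → unit u v * boundary a u)
      ≈⟨ adjoint (λ u → unit u v) a ⟩
    sum (λ e → a e * y e)
      ≈⟨ sum-cong-≋ (λ e → trans (*-congʳ (a≈ e)) (*-distribʳ-sum (y e) (λ j → c j * cycleVector j e))) ⟩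
    sum (λ e → sum (λ j → c j * cycleVector j e * y e))
      ≈⟨ ∑-comm (λ e j → c j * cycleVector j e * y e) ⟩
    sum (λ j → sum (λ e → c j * cycleVector j e * y e))
      ≈⟨ sum-zero (λ j → trans (sum-cong-≋ (λ e → rearrange (c j) (cycleVector j e) (y e)))
           (trans (sym (*-distribˡ-sum (c j) (λ e → y e * cycleVector j e)))
             (trans (*-congˡ (trans (sum-indicator (cycle (lookup outside j)) y) (cycle-closed (λ u → unit u v) (lookup outside j))))
               (zeroʳ (c j))))) ⟩
    0# ∎
    where
    open ≈-Reasoning
    y = coboundary (λ u → unit u v)
    rearrange : ∀ c x y → c * x * y ≈ c * (y * x)
    rearrange = solve 3 (λ c x y → c :* x :* y := c :* (y :* x)) refl
      where open Solver

  unique-edges : Unique outside × (∀ {e} → e ∈ inside → e ∉ outside)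
  unique-edges = unique-++ inside
    (SetoidPermutation.Unique-resp-↭ (≡.setoid (Fin #E)) (↭⇒↭ₛ allEdges) (Unique.allFin⁺ #E))

  -- Apart from its own edge a fundamental cycle stays in the forest, where the unit function of an
  -- outside edge vanishes. So the cycle vectors restrict to the identity matrix on `outside`, which
  -- makes them independent.
  cycleVector-≡ : ∀ i j → cycleVector j (lookup outside i) ≈ unit (lookup outside i) (lookup outside j)
  cycleVector-≡ i j = trans (along-cycle (unit e) (lookup outside j))
    (trans (+-congˡ (-‿cong (+-cong (vanish _) (-‿cong (vanish _)))))
      (trans (+-congˡ (-‿cong (-‿inverseʳ 0#))) (trans (+-congˡ -0#≈0#) (+-identityʳ _))))
    where
    e = lookup outside i
    vanish : ∀ v → potential (unit e) v ≈ 0#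
    vanish = path-inside (unit e) λ e₁∈ → unit-≢ λ e≡e₁ →
      proj₂ unique-edges e₁∈ (subst (_∈ outside) e≡e₁ (∈-lookup i))

  cycleVectors-independent : ∀ (c : Fin (length outside) → Carrier) → (∀ e → sum (λ j → c j * cycleVector j e) ≈ 0#) → ∀ i → c i ≈ 0#
  cycleVectors-independent c combination≈0 i = begin
    c i                                                   ≈⟨ *-identityʳ (c i) ⟨
    c i * 1#                                              ≈⟨ *-congˡ (trans (cycleVector-≡ i i) (unit-≡ (lookup outside i))) ⟨
    c i * cycleVector i (lookup outside i)                ≈⟨ sum-select i (λ j → c j * cycleVector j (lookup outside i)) (λ j j≢i →
      trans (*-congˡ (trans (cycleVector-≡ i j) (unit-≢ λ eq → j≢i (≡.sym (lookup-injective (proj₁ unique-edges) eq))))) (zeroʳ (c j))) ⟨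
    sum (λ j → c j * cycleVector j (lookup outside i))    ≈⟨ combination≈0 (lookup outside i) ⟩
    0#                                                    ∎
    where open ≈-Reasoning

  energy-tour : ∀ a → energy a tour ≤ sum (λ e → a e * a e) + sum (λ e → a e * a e)
  energy-tour a = begin
    energy a tour                                ≈⟨ energy-edges tour ⟩
    ∑ f (map edge tour)                          ≈⟨ trans (∑-↭ f tourEdges) (∑-++ f inside inside) ⟩
    ∑ f inside + ∑ f inside                      ≲⟨ +-mono-≤ inside≤ inside≤ ⟩
    sum f + sum f                                ∎
    where
    open ≤-Reasoning
    f : Fin #E → Carrier
    f e = a e * a e
    energy-edges : ∀ l → energy a l ≈ ∑ f (map edge l)
    energy-edges []      = refl
    energy-edges (d ∷ l) = +-congˡ (energy-edges l)
    inside≤ : ∑ f inside ≤ sum f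
    inside≤ = begin
      ∑ f inside                 ≈⟨ +-identityʳ _ ⟨
      ∑ f inside + 0#            ≲⟨ +-mono-≤ ≤-refl (∑-nonNeg (λ e → 0≤x² (a e)) outside) ⟩
      ∑ f inside + ∑ f outside   ≈⟨ ∑-++ f inside outside ⟨
      ∑ f (inside ++ outside)    ≈⟨ ∑-↭ f allEdges ⟨
      ∑ f (allFin #E)            ≈⟨ reflexive (∑-tabulate f id) ⟩
      sum f                      ∎

  private
    L-pieces : ∀ L → ∃₂ λ cs r → tour ≡ concat cs ++ r ×
      (∀ {c} → c ∈ cs → length c ℕ.≤ suc L) × length r ℕ.≤ suc L × length cs ℕ.* suc L ℕ.≤ length tour
    L-pieces L = cut L (length tour) tour ℕ.≤-refl

  pieces : ℕ → List (List Dart)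
  pieces L = proj₁ (L-pieces L)

  length-pieces : ∀ L → length (pieces L) ℕ.* suc L ℕ.≤ 2 ℕ.* #E
  length-pieces L = begin
    length (pieces L) ℕ.* suc L        ≤⟨ proj₂ (proj₂ (proj₂ (proj₂ (proj₂ (L-pieces L))))) ⟩
    length tour                        ≡⟨ List.length-map edge tour ⟨
    length (map edge tour)             ≡⟨ ↭-length tourEdges ⟩
    length (inside ++ inside)          ≡⟨ List.length-++ inside ⟩
    length inside ℕ.+ length inside    ≤⟨ ℕ.+-mono-≤ inside≤ inside≤ ⟩
    #E ℕ.+ #E                          ≡⟨ cong (#E ℕ.+_) (ℕ.+-identityʳ #E) ⟨
    2 ℕ.* #E                           ∎
    where
    open ℕ.≤-Reasoning
    inside≤ : length inside ℕ.≤ #E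
    inside≤ = begin
      length inside                        ≤⟨ ℕ.m≤m+n _ _ ⟩
      length inside ℕ.+ length outside     ≡⟨ List.length-++ inside ⟨
      length (inside ++ outside)           ≡⟨ ↭-length allEdges ⟨
      length (allFin #E)                   ≡⟨ List.length-tabulate id ⟩
      #E                                   ∎

  along-concat : ∀ a cs → (∀ {c} → c ∈ cs → along a c ≈ 0#) → along a (concat cs) ≈ 0#
  along-concat a []       _    = refl
  along-concat a (c ∷ cs) cs≈0 = trans (∑-++ (value a) c (concat cs))
    (trans (+-cong (cs≈0 (here ≡.refl)) (along-concat a cs (cs≈0 ∘ there))) (+-identityʳ 0#))

  potential-≤ : ∀ a L → (∀ {c} → c ∈ pieces L → along a c ≈ 0#) →
    nat 4 * sum (λ v → potential a v * potential a v) ≤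
    nat L * nat (suc L) * (sum (λ e → a e * a e) + sum (λ e → a e * a e))
  potential-≤ a L pieces≈0 with L-pieces L
  ... | cs , r , tour≡ , cs≤ , r≤ , _ = begin
    nat 4 * sum (λ v → potential a v * potential a v)
      ≲⟨ *-monoʳ-≤ (0≤nat 4) (visited a) ⟩
    nat 4 * visited² a 0# tour
      ≈⟨ *-congˡ (reflexive (cong (visited² a 0#) tour≡)) ⟩
    nat 4 * visited² a 0# (concat cs ++ r)
      ≲⟨ visited²-concat-≤ a L cs r cs≤ r≤ pieces≈0 r≈0 ⟩
    nat L * nat (suc L) * energy a (concat cs ++ r)
      ≈⟨ *-congˡ (reflexive (cong (energy a) (≡.sym tour≡))) ⟩
    nat L * nat (suc L) * energy a tour
      ≲⟨ *-monoʳ-≤ (0≤x*y (0≤nat L) (0≤nat (suc L))) (energy-tour a) ⟩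
    nat L * nat (suc L) * (sum (λ e → a e * a e) + sum (λ e → a e * a e)) ∎
    where
    open ≤-Reasoning
    -- The remainder costs no linear condition: the whole tour has sum zero, and so do all the
    -- pieces before it.
    r≈0 : along a r ≈ 0#
    r≈0 = trans (sym (+-identityˡ _)) (trans (+-congʳ (sym (along-concat a cs pieces≈0)))
      (trans (sym (∑-++ (value a) (concat cs) r))
        (trans (reflexive (cong (along a) (≡.sym tour≡))) (tour-closed a))))

  term-≤-sum : ∀ {n} {f : Fin n → Carrier} → (∀ i → 0# ≤ f i) → ∀ i → f i ≤ sum f
  term-≤-sum {suc n} {f} 0≤f i = begin
    f i                                    ≈⟨ +-identityʳ (f i) ⟨
    f i + 0#                               ≈⟨ +-congˡ (sum-replicate-zero n) ⟨
    f i + sum (λ (_ : Fin n) → 0#)         ≲⟨ +-mono-≤ ≤-refl (sum-mono-≤ λ j → 0≤f (punchIn i j)) ⟩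
    f i + sum (λ j → f (punchIn i j))      ≈⟨ sum-remove f ⟨
    sum f                                  ∎
    where open ≤-Reasoning

  -- With A = |a|², B = |∂a|² and x the potential of a, so that A = ⟨x , ∂a⟩ and
  -- 4|x|² ≤ 2κA, expanding 0 ≤ |2x − κ∂a|² gives κ(2 − κQ)A ≤ 0 if B ≤ QA.
  vanishing : ∀ a L Q → let κ = nat L * nat (suc L) in
    0# < κ * (nat 2 - κ * Q) →
    (∀ {e} → e ∈ outside → along a (cycle e) ≈ 0#) →
    (∀ {c} → c ∈ pieces L → along a c ≈ 0#) →
    sum (λ v → boundary a v * boundary a v) ≤ Q * sum (λ e → a e * a e) →
    ∀ e → a e ≈ 0#
  vanishing a L Q 0<gap cycles≈0 pieces≈0 B≤QA e =
    x²≤0⇒x≈0 (≤-trans (term-≤-sum {f = λ e → a e * a e} (λ e → 0≤x² (a e)) e) (c*x≤0⇒x≤0 0<gap gapA≤0))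
    where
    open ≤-Reasoning
    open Solver
    κ = nat L * nat (suc L)
    x = potential a
    b = boundary a
    A = sum (λ e → a e * a e)
    B = sum (λ v → b v * b v)
    xx = sum (λ v → x v * x v)
    xb = sum (λ v → x v * b v)
    0≤κ² : 0# ≤ κ * κ
    0≤κ² = 0≤x² κ
    xb≈A : xb ≈ A
    xb≈A = trans (adjoint x a) (sum-cong-≋ λ e → *-congˡ (sym (exact a cycles≈0 e)))
    -- The weights 2 and κ give 2x and κ∂a equal norms in the critical case |x|² = ½κA, B = QA, κQ =
    -- 2, where the estimate has to be sharp.
    square : Fin #V → Carrier
    square v = (nat 2 * x v - κ * b v) * (nat 2 * x v - κ * b v)
    expand : sum square ≈ (nat 4 * xx + (- (nat 4 * κ)) * xb) + κ * κ * B
    expand = trans (sum-cong-≋ λ v → solve 3 (λ k x b → (con (ℤ.+ 2 ℚ./ 1) :* x :- k :* b) :* (con (ℤ.+ 2 ℚ./ 1) :* x :- k :* b)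
        := (con (ℤ.+ 4 ℚ./ 1) :* (x :* x) :+ (:- (con (ℤ.+ 4 ℚ./ 1) :* k)) :* (x :* b)) :+ k :* k :* (b :* b)) refl κ (x v) (b v))
      (trans (∑-distrib-+ (λ v → nat 4 * (x v * x v) + (- (nat 4 * κ)) * (x v * b v)) (λ v → κ * κ * (b v * b v)))
        (+-cong (sum-linear (nat 4) (- (nat 4 * κ)) (λ v → x v * x v) (λ v → x v * b v))
                (sym (*-distribˡ-sum (κ * κ) (λ v → b v * b v)))))
    gapA≤0 : κ * (nat 2 - κ * Q) * A ≤ 0#
    gapA≤0 = begin
      κ * (nat 2 - κ * Q) * A
        ≈⟨ +-identityʳ _ ⟨
      κ * (nat 2 - κ * Q) * A + 0#
        ≲⟨ +-mono-≤ ≤-refl (≤-trans (≤-reflexive (sym (sum-zero {#V} λ _ → refl))) (sum-mono-≤ λ v → 0≤x² (nat 2 * x v - κ * b v))) ⟩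
      κ * (nat 2 - κ * Q) * A + sum square
        ≈⟨ +-congˡ (trans expand (+-congʳ (+-congˡ (*-congˡ xb≈A)))) ⟩
      κ * (nat 2 - κ * Q) * A + ((nat 4 * xx + (- (nat 4 * κ)) * A) + κ * κ * B)
        ≲⟨ +-mono-≤ ≤-refl (+-mono-≤ (+-mono-≤ (potential-≤ a L pieces≈0) ≤-refl) (*-monoʳ-≤ 0≤κ² B≤QA)) ⟩
      κ * (nat 2 - κ * Q) * A + ((κ * (A + A) + (- (nat 4 * κ)) * A) + κ * κ * (Q * A))
        ≈⟨ solve 3 (λ k q a → k :* (con (ℤ.+ 2 ℚ./ 1) :- k :* q) :* a :+ ((k :* (a :+ a) :+ (:- (con (ℤ.+ 4 ℚ./ 1) :* k)) :* a) :+ k :* k :* (q :* a)) := con 0ℚ) refl κ Q A ⟩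
      ι 0ℚ
        ≈⟨ ι0≈0 ⟩
      0# ∎

  rank-≤ : ∀ L Q → let κ = nat L * nat (suc L) in 0# < κ * (nat 2 - κ * Q) →
    ∀ {k} (b : Fin k → Fin #E → Carrier) →
    (∀ (c : Fin k → Carrier) → (∀ e → sum (λ j → c j * b j e) ≈ 0#) → ∀ j → c j ≈ 0#) →
    (∀ (c : Fin k → Carrier) → let a = λ e → sum (λ j → c j * b j e) in
      sum (λ v → boundary a v * boundary a v) ≤ Q * sum (λ e → a e * a e)) →
    -- The conditions are one zero sum for each fundamental cycle and each piece. With more basis
    -- vectors than conditions, some nontrivial combination meets them all, and `vanishing`
    -- contradicts independence.
    k ℕ.≤ length outside ℕ.+ length (pieces L)
  rank-≤ L Q 0<gap {k} b independent bounded = ℕ.≮⇒≥ λ few →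
    nontrivialSolution (length walks) (ℕ.≤-<-trans (ℕ.≤-reflexive length-walks) few)
      (λ i j → along (b j) (lookup walks i)) λ (c , (j , cj≉0) , solves) →
      let a = λ e → sum (λ j → c j * b j e)
          walks≈0 : ∀ {l} → l ∈ walks → along a l ≈ 0#
          walks≈0 {l} l∈ = trans (along-linear c b l)
            (trans (reflexive (cong (λ l → sum (λ j → c j * along (b j) l)) (lookup-index l∈)))
              (trans (sum-cong-≋ λ j → *-comm (c j) _) (solves (Any.index l∈))))
      in cj≉0 (independent c (vanishing a L Q 0<gap
           (λ e∈ → walks≈0 (∈-++⁺ˡ (∈-map⁺ cycle e∈)))
           (λ l∈ → walks≈0 (∈-++⁺ʳ (map cycle outside) l∈)) (bounded c)) j)
    where
    walks : List (List Dart)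
    walks = map cycle outside ++ pieces L
    length-walks : length walks ≡ length outside ℕ.+ length (pieces L)
    length-walks = ≡.trans (List.length-++ (map cycle outside)) (cong (ℕ._+ length (pieces L)) (List.length-map cycle outside))

  Span : ∀ {n} → (Fin n → Fin #E → Carrier) → (Fin #E → Carrier) → Set
  Span {n} z a = ∃ λ (c : Fin n → Carrier) → ∀ e → a e ≈ sum (λ j → c j * z j e)

  module _ {n} (z : Fin n → Fin #E → Carrier) where
    span-0 : Span z (λ _ → 0#)
    span-0 = (λ _ → 0#) , λ e → sym (sum-zero λ j → zeroˡ (z j e))

    span-+ : ∀ {a b} → Span z a → Span z b → Span z (λ e → a e + b e)
    span-+ (c , a≈) (c′ , b≈) = (λ j → c j + c′ j) , λ e → trans (+-cong (a≈ e) (b≈ e))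
      (trans (sym (∑-distrib-+ (λ j → c j * z j e) (λ j → c′ j * z j e)))
        (sum-cong-≋ λ j → sym (distribʳ (z j e) (c j) (c′ j))))

    span-* : ∀ x {a} → Span z a → Span z (λ e → x * a e)
    span-* x (c , a≈) = (λ j → x * c j) , λ e → trans (*-congˡ (a≈ e))
      (trans (*-distribˡ-sum x (λ j → c j * z j e)) (sum-cong-≋ λ j → sym (*-assoc x (c j) (z j e))))

    span-resp : ∀ {a b} → (∀ e → a e ≈ b e) → Span z a → Span z b
    span-resp a≈b (c , a≈) = c , λ e → trans (sym (a≈b e)) (a≈ e)

    span-generator : ∀ i → Span z (z i)
    span-generator i = (λ j → unit j i) , λ e → sym (trans (sum-cong-≋ λ j → *-comm (unit j i) (z j e))
      (sum-unit (λ j → z j e) i))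

  nat-+ : ∀ m n → nat (m ℕ.+ n) ≈ nat m + nat n
  nat-+ zero    n = sym (trans (+-congʳ ι0≈0) (+-identityˡ (nat n)))
  nat-+ (suc m) n = trans (nat-suc (m ℕ.+ n)) (trans (+-congʳ (nat-+ m n))
    (trans (solve 3 (λ m n o → m :+ n :+ o := m :+ o :+ n) refl (nat m) (nat n) 1#) (+-congʳ (sym (nat-suc m)))))
    where open Solver

  nat-* : ∀ m n → nat (m ℕ.* n) ≈ nat m * nat n
  nat-* zero    n = trans ι0≈0 (sym (trans (*-congʳ ι0≈0) (zeroˡ (nat n))))
  nat-* (suc m) n = trans (nat-+ n (m ℕ.* n)) (trans (+-congˡ (nat-* m n))
    (sym (trans (*-congʳ (nat-suc m)) (trans (distribʳ (nat n) (nat m) 1#)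
      (trans (+-congˡ (*-identityˡ (nat n))) (+-comm (nat m * nat n) (nat n)))))))

  nat-≤-* : ∀ P L m {q} → P ℕ.* L ℕ.≤ m → 0# ≤ q → 1# ≤ nat L * q → nat P ≤ nat m * q
  nat-≤-* P L m {q} PL≤m 0≤q 1≤Lq = begin
    nat P                  ≈⟨ *-identityʳ (nat P) ⟨
    nat P * 1#             ≲⟨ *-monoʳ-≤ (0≤nat P) 1≤Lq ⟩
    nat P * (nat L * q)    ≈⟨ *-assoc (nat P) (nat L) q ⟨
    nat P * nat L * q      ≈⟨ *-congʳ (nat-* P L) ⟨
    nat (P ℕ.* L) * q      ≲⟨ *-mono-≤ (0≤nat m) 0≤q (nat-mono-≤ PL≤m) ≤-refl ⟩
    nat m * q              ∎
    where open ≤-Reasoning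

  square-≤ : ∀ {r q s t} → 0# ≤ s → 0# ≤ t → r ≤ q → s ≤ r * t → s * s ≤ q * q * (t * t)
  square-≤ {r} {q} {s} {t} 0≤s 0≤t r≤q s≤rt = ≤-trans (*-mono-≤ (≤-trans 0≤s s≤qt) 0≤s s≤qt s≤qt)
    (≤-reflexive (solve 2 (λ q t → q :* t :* (q :* t) := q :* q :* (t :* t)) refl q t))
    where
    open Solver
    s≤qt : s ≤ q * t
    s≤qt = ≤-trans s≤rt (≤-trans (≤-reflexive (*-comm r t)) (≤-trans (*-monoʳ-≤ 0≤t r≤q) (≤-reflexive (*-comm t q))))

  ≤-+⇒-≤ : ∀ {x y z} → x ≤ y + z → x - y ≤ z
  ≤-+⇒-≤ {x} {y} {z} x≤y+z = ≤-trans (+-mono-≤ x≤y+z ≤-refl)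
    (≤-reflexive (solve 2 (λ y z → y :+ z :- y := z) refl y z))
    where open Solver

-- Real numbers

open import Defs
open ≡ using (refl; sym; trans)

module ℚSolver = ℚ.+-*-Solver

⊔-bounds : ∀ M N {n} → M ℕ.⊔ N ℕ.≤ n → M ℕ.≤ n × N ℕ.≤ n
⊔-bounds M N M⊔N≤n = ℕ.m⊔n≤o⇒m≤o M N M⊔N≤n , ℕ.m⊔n≤o⇒n≤o M N M⊔N≤n

p≤∣p∣ : ∀ p → p ℚ.≤ ∣ p ∣
p≤∣p∣ p with ℚ.≤-total 0ℚ p
... | inj₁ 0≤p = ℚ.≤-reflexive (sym (ℚ.0≤p⇒∣p∣≡p 0≤p))
... | inj₂ p≤0 = ℚ.≤-trans p≤0 (ℚ.0≤∣p∣ p)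

difference : ∀ p q → p ≡ q ℚ.+ (p ℚ.- q)
difference = solve 2 (λ p q → p := q :+ (p :- q)) refl
  where open ℚSolver

∣-∣≤⇒≤+ : ∀ {p q ε} → ∣ p ℚ.- q ∣ ℚ.≤ ε → p ℚ.≤ q ℚ.+ ε
∣-∣≤⇒≤+ {p} {q} {ε} p-q≤ε = begin
  p                  ≡⟨ difference p q ⟩
  q ℚ.+ (p ℚ.- q)    ≤⟨ ℚ.+-monoʳ-≤ q (p≤∣p∣ (p ℚ.- q)) ⟩
  q ℚ.+ ∣ p ℚ.- q ∣  ≤⟨ ℚ.+-monoʳ-≤ q p-q≤ε ⟩
  q ℚ.+ ε            ∎
  where open ℚ.≤-Reasoning

∣-∣-sym : ∀ p q → ∣ p ℚ.- q ∣ ≡ ∣ q ℚ.- p ∣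
∣-∣-sym p q = trans (sym (ℚ.∣-p∣≡∣p∣ (p ℚ.- q))) (cong ∣_∣ (lem p q))
  where
  lem : ∀ p q → ℚ.- (p ℚ.- q) ≡ q ℚ.- p
  lem = solve 2 (λ p q → :- (p :- q) := q :- p) refl
    where open ℚSolver

pointwise : ∀ {x y} → (∀ n → seq x n ≡ seq y n) → x ≈ y
pointwise {x} {y} eq ε 0<ε = 0 , λ n _ → ℚ.≤-trans
  (ℚ.≤-reflexive (trans (cong (λ z → ∣ z ℚ.- seq y n ∣) (eq n)) (cong ∣_∣ (ℚ.+-inverseʳ (seq y n)))))
  (ℚ.<⇒≤ 0<ε)

≈-refl : ∀ {x} → x ≈ x
≈-refl {x} = pointwise {x} {x} λ _ → refl

≈-sym : ∀ {x y} → x ≈ y → y ≈ x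
≈-sym {x} {y} x≈y ε 0<ε with x≈y ε 0<ε
... | N , p = N , λ n N≤n → ℚ.≤-trans (ℚ.≤-reflexive (∣-∣-sym (seq y n) (seq x n))) (p n N≤n)

-- Equivalent to _≤_, but not a negation and hence composable.
infix 4 _≲_
_≲_ : ℝ → ℝ → Set
x ≲ y = ∀ ε → 0ℚ ℚ.< ε → ∃ λ N → ∀ n → N ℕ.≤ n → seq x n ℚ.≤ seq y n ℚ.+ ε

+½+½ : ∀ p ε → p ℚ.+ ½ ℚ.* ε ℚ.+ ½ ℚ.* ε ≡ p ℚ.+ ε
+½+½ p ε = trans (ℚ.+-assoc p (½ ℚ.* ε) (½ ℚ.* ε)) (cong (p ℚ.+_) (half+half ε))

p≤p+ε : ∀ p {ε} → 0ℚ ℚ.≤ ε → p ℚ.≤ p ℚ.+ ε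
p≤p+ε p {ε} 0≤ε = ℚ.≤-trans (ℚ.≤-reflexive (sym (ℚ.+-identityʳ p))) (ℚ.+-monoʳ-≤ p 0≤ε)

p<p+ε : ∀ p {ε} → 0ℚ ℚ.< ε → p ℚ.< p ℚ.+ ε
p<p+ε p {ε} 0<ε = ℚ.≤-<-trans (ℚ.≤-reflexive (sym (ℚ.+-identityʳ p))) (ℚ.+-monoʳ-< p 0<ε)

≲⇒≤ : ∀ {x y} → x ≲ y → x ≤ y
≲⇒≤ {x} {y} x≲y (ε , 0<ε , N , p) with x≲y (½ ℚ.* ε) (half 0<ε)
... | M , q = ℚ.<-irrefl refl
  (ℚ.<-≤-trans (p<p+ε (seq y n ℚ.+ ½ ℚ.* ε) (half 0<ε))
  (ℚ.≤-trans (ℚ.≤-reflexive (+½+½ (seq y n) ε))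
  (ℚ.≤-trans (p n (ℕ.m≤m⊔n N M)) (q n (ℕ.m≤n⊔m N M)))))
  where
  n = N ℕ.⊔ M

-- Comparison of rationals is decidable, so one index `N`, from which on the difference varies by at
-- most δ, is enough: a gap above 2δ there would persist as a gap of δ and make y < x. Later terms
-- then differ by at most 3δ, which is below ε = 4δ.
≤⇒≲ : ∀ {x y} → x ≤ y → x ≲ y
≤⇒≲ {x} {y} x≤y ε 0<ε = N , λ n N≤n → ℚ.≤-trans (ℚ.≤-reflexive (difference (seq x n) (seq y n)))
    (ℚ.+-monoʳ-≤ (seq y n) (bound n N≤n))
  where
  δ = ½ ℚ.* (½ ℚ.* ε)
  0<δ : 0ℚ ℚ.< δ
  0<δ = half (half 0<ε)
  N = proj₁ (cauchy (x - y) δ 0<δ)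
  close : ∀ m n → N ℕ.≤ m → N ℕ.≤ n → ∣ (seq x m ℚ.- seq y m) ℚ.- (seq x n ℚ.- seq y n) ∣ ℚ.≤ δ
  close = proj₂ (cauchy (x - y) δ 0<δ)
  gap : ∀ z w {δ} → δ ℚ.+ δ ℚ.≤ w → w ℚ.≤ z ℚ.+ δ → δ ℚ.≤ z
  gap z w {δ} 2δ≤w w≤ = subst₂ ℚ._≤_ (lem δ) (lem′ z δ) (ℚ.+-monoˡ-≤ (ℚ.- δ) (ℚ.≤-trans 2δ≤w w≤))
    where
    lem : ∀ δ → δ ℚ.+ δ ℚ.- δ ≡ δ
    lem = solve 1 (λ δ → δ :+ δ :- δ := δ) refl
      where open ℚSolver
    lem′ : ∀ z δ → z ℚ.+ δ ℚ.- δ ≡ z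
    lem′ = solve 2 (λ z δ → z :+ δ :- δ := z) refl
      where open ℚSolver
  +-≤ : ∀ p q {δ} → δ ℚ.≤ p ℚ.- q → q ℚ.+ δ ℚ.≤ p
  +-≤ p q δ≤ = ℚ.≤-trans (ℚ.+-monoʳ-≤ q δ≤) (ℚ.≤-reflexive (sym (difference p q)))
  small : seq x N ℚ.- seq y N ℚ.≤ δ ℚ.+ δ
  small = ℚ.≮⇒≥ λ 2δ< → x≤y (δ , 0<δ , N , λ n N≤n → +-≤ (seq x n) (seq y n)
    (gap (seq x n ℚ.- seq y n) (seq x N ℚ.- seq y N) (ℚ.<⇒≤ 2δ<) (∣-∣≤⇒≤+ (close N n ℕ.≤-refl N≤n))))
  bound : ∀ n → N ℕ.≤ n → seq x n ℚ.- seq y n ℚ.≤ ε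
  bound n N≤n = ℚ.≤-trans (∣-∣≤⇒≤+ (close n N N≤n ℕ.≤-refl))
    (ℚ.≤-trans (ℚ.+-monoˡ-≤ δ small)
    (ℚ.≤-trans (p≤p+ε (δ ℚ.+ δ ℚ.+ δ) (ℚ.<⇒≤ 0<δ)) (ℚ.≤-reflexive (lem ε))))
    where
    lem : ∀ ε → let δ = ½ ℚ.* (½ ℚ.* ε) in δ ℚ.+ δ ℚ.+ δ ℚ.+ δ ≡ ε
    lem = solve 1 (λ ε → let δ = con ½ :* (con ½ :* ε) in δ :+ δ :+ δ :+ δ := ε) refl
      where open ℚSolver

≈⇒≲ : ∀ {x y} → x ≈ y → x ≲ y
≈⇒≲ x≈y ε 0<ε with x≈y ε 0<ε
... | N , p = N , λ n N≤n → ∣-∣≤⇒≤+ (p n N≤n)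

≲-antisym : ∀ {x y} → x ≲ y → y ≲ x → x ≈ y
≲-antisym x≲y y≲x ε 0<ε with x≲y ε 0<ε | y≲x ε 0<ε
... | N , p | M , q = N ℕ.⊔ M , λ n N≤n →
  ∣-∣≤ (p n (proj₁ (⊔-bounds N M N≤n))) (q n (proj₂ (⊔-bounds N M N≤n)))

+-mono-≲ : ∀ {x y z w} → x ≲ y → z ≲ w → x + z ≲ y + w
+-mono-≲ {x} {y} {z} {w} x≲y z≲w ε 0<ε with x≲y _ (half 0<ε) | z≲w _ (half 0<ε)
... | N , p | M , q = N ℕ.⊔ M , λ n N≤n → ℚ.≤-trans
  (ℚ.+-mono-≤ (p n (proj₁ (⊔-bounds N M N≤n))) (q n (proj₂ (⊔-bounds N M N≤n))))
  (ℚ.≤-reflexive (lem (seq y n) (seq w n) ε))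
  where
  lem : ∀ y w ε → y ℚ.+ ½ ℚ.* ε ℚ.+ (w ℚ.+ ½ ℚ.* ε) ≡ y ℚ.+ w ℚ.+ ε
  lem = solve 3 (λ y w ε → y :+ con ½ :* ε :+ (w :+ con ½ :* ε) := y :+ w :+ ε) refl
    where open ℚSolver

≲-trans : ∀ {x y z} → x ≲ y → y ≲ z → x ≲ z
≲-trans {x} {y} {z} x≲y y≲z ε 0<ε with x≲y _ (half 0<ε) | y≲z _ (half 0<ε)
... | N , p | M , q = N ℕ.⊔ M , λ n N≤n →
  ℚ.≤-trans (p n (proj₁ (⊔-bounds N M N≤n)))
  (ℚ.≤-trans (ℚ.+-monoˡ-≤ (½ ℚ.* ε) (q n (proj₂ (⊔-bounds N M N≤n))))
  (ℚ.≤-reflexive (+½+½ (seq z n) ε)))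

≈-trans : ∀ {x y z} → x ≈ y → y ≈ z → x ≈ z
≈-trans {x} {y} {z} x≈y y≈z = ≲-antisym {x} {z}
  (≲-trans {x} {y} {z} (≈⇒≲ {x} {y} x≈y) (≈⇒≲ {y} {z} y≈z))
  (≲-trans {z} {y} {x} (≈⇒≲ {z} {y} (≈-sym {y} {z} y≈z)) (≈⇒≲ {y} {x} (≈-sym {x} {y} x≈y)))

+-cong : ∀ {x y z w} → x ≈ y → z ≈ w → x + z ≈ y + w
+-cong {x} {y} {z} {w} x≈y z≈w = ≲-antisym {x + z} {y + w}
  (+-mono-≲ {x} {y} {z} {w} (≈⇒≲ {x} {y} x≈y) (≈⇒≲ {z} {w} z≈w))
  (+-mono-≲ {y} {x} {w} {z} (≈⇒≲ {y} {x} (≈-sym {x} {y} x≈y)) (≈⇒≲ {w} {z} (≈-sym {z} {w} z≈w)))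

neg-cong : ∀ {x y} → x ≈ y → - x ≈ - y
neg-cong {x} {y} x≈y ε 0<ε with x≈y ε 0<ε
... | N , p = N , λ n N≤n → ℚ.≤-trans (ℚ.≤-reflexive (lem (seq x n) (seq y n))) (p n N≤n)
  where
  lem : ∀ x y → ∣ (ℚ.- x) ℚ.- (ℚ.- y) ∣ ≡ ∣ x ℚ.- y ∣
  lem x y = trans (cong ∣_∣ (sym (ℚ.neg-distrib-+ x (ℚ.- y)))) (ℚ.∣-p∣≡∣p∣ (x ℚ.- y))

*-cong : ∀ {x y z w} → x ≈ y → z ≈ w → x * z ≈ y * w
*-cong {x} {y} {z} {w} x≈y z≈w ε 0<ε =
  let A , 0<A , M₁ , bx = eventuallyBounded {seq x} (cauchy x)
      B , 0<B , M₂ , bw = eventuallyBounded {seq w} (cauchy w)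
      α , 0<α , Aα≡ = fraction (half 0<ε) 0<A
      β , 0<β , Bβ≡ = fraction (half 0<ε) 0<B
      N₁ , pz = z≈w α 0<α
      N₂ , px = x≈y β 0<β
      M = M₁ ℕ.⊔ M₂
      N = N₁ ℕ.⊔ N₂
  in M ℕ.⊔ N , λ n K≤n →
    let M≤n , N≤n = ⊔-bounds M N K≤n
        M₁≤n , M₂≤n = ⊔-bounds M₁ M₂ M≤n
        N₁≤n , N₂≤n = ⊔-bounds N₁ N₂ N≤n
    in product-close (seq x n) (seq z n) (seq y n) (seq w n) A B α β 0<A 0<B Aα≡ Bβ≡
         (bx n M₁≤n) (bw n M₂≤n) (px n N₂≤n) (pz n N₁≤n)

ℝ-ring : CommutativeRing 0ℓ 0ℓ
ℝ-ring = record
  { Carrier = ℝ ; _≈_ = _≈_ ; _+_ = _+_ ; _*_ = _*_ ; -_ = -_ ; 0# = 0ℝ ; 1# = 1ℝ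
  ; isCommutativeRing = record
    { isRing = record
      { +-isAbelianGroup = record
        { isGroup = record
          { isMonoid = record
            { isSemigroup = record
              { isMagma = record
                { isEquivalence = record
                  { refl  = λ {x} → ≈-refl {x}
                  ; sym   = λ {x} {y} → ≈-sym {x} {y}
                  ; trans = λ {x} {y} {z} → ≈-trans {x} {y} {z} }
                ; ∙-cong = λ {x} {y} {z} {w} → +-cong {x} {y} {z} {w} }
              ; assoc = λ x y z → pointwise {x + y + z} {x + (y + z)} λ n → ℚ.+-assoc (seq x n) (seq y n) (seq z n) }
            ; identity = (λ x → pointwise {0ℝ + x} {x} λ n → ℚ.+-identityˡ (seq x n))
                       , (λ x → pointwise {x + 0ℝ} {x} λ n → ℚ.+-identityʳ (seq x n)) }
          ; inverse = (λ x → pointwise { - x + x} {0ℝ} λ n → ℚ.+-inverseˡ (seq x n))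
                    , (λ x → pointwise {x + - x} {0ℝ} λ n → ℚ.+-inverseʳ (seq x n))
          ; ⁻¹-cong = λ {x} {y} → neg-cong {x} {y} }
        ; comm = λ x y → pointwise {x + y} {y + x} λ n → ℚ.+-comm (seq x n) (seq y n) }
      ; *-cong = λ {x} {y} {z} {w} → *-cong {x} {y} {z} {w}
      ; *-assoc = λ x y z → pointwise {x * y * z} {x * (y * z)} λ n → ℚ.*-assoc (seq x n) (seq y n) (seq z n)
      ; *-identity = (λ x → pointwise {1ℝ * x} {x} λ n → ℚ.*-identityˡ (seq x n))
                   , (λ x → pointwise {x * 1ℝ} {x} λ n → ℚ.*-identityʳ (seq x n))
      ; distrib = (λ x y z → pointwise {x * (y + z)} {x * y + x * z} λ n → ℚ.*-distribˡ-+ (seq x n) (seq y n) (seq z n))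
                , (λ x y z → pointwise {(y + z) * x} {y * x + z * x} λ n → ℚ.*-distribʳ-+ (seq x n) (seq y n) (seq z n)) }
    ; *-comm = λ x y → pointwise {x * y} {y * x} λ n → ℚ.*-comm (seq x n) (seq y n) } }


≤-stable : ∀ {x y} → ¬ ¬ x ≤ y → x ≤ y
≤-stable ¬¬x≤y y<x = ¬¬x≤y λ x≤y → x≤y y<x

-- The root was made total as √∣x∣, so this is what its square equals.
absolute : ℝ → ℝ
absolute x = mkℝ (λ n → ∣ seq x n ∣) λ ε 0<ε → let N , p = cauchy x ε 0<ε in
  N , λ m n N≤m N≤n → ∣-∣≤ {∣ seq x m ∣} {∣ seq x n ∣}
    (ℚ.≤-trans (∣∣-triangle (seq x m) (seq x n)) (ℚ.+-monoʳ-≤ ∣ seq x n ∣ (p m n N≤m N≤n)))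
    (ℚ.≤-trans (∣∣-triangle (seq x n) (seq x m)) (ℚ.+-monoʳ-≤ ∣ seq x m ∣ (p n m N≤n N≤m)))

∣p∣≤p+ε : ∀ p {ε} → 0ℚ ℚ.< ε → 0ℚ ℚ.≤ p ℚ.+ ½ ℚ.* ε → ∣ p ∣ ℚ.≤ p ℚ.+ ε
∣p∣≤p+ε p {ε} 0<ε 0≤ with ℚ.∣p∣≡p∨∣p∣≡-p p
... | inj₁ eq = ℚ.≤-trans (ℚ.≤-reflexive eq) (p≤p+ε p (ℚ.<⇒≤ 0<ε))
... | inj₂ eq = ℚ.≤-trans (ℚ.≤-reflexive eq)
    (ℚ.≤-trans (p≤p+ε (ℚ.- p) {δ ℚ.+ δ} (ℚ.+-mono-≤ {0ℚ} {δ} {0ℚ} {δ} 0≤ 0≤)) (ℚ.≤-reflexive (lem p ε)))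
  where
  δ = p ℚ.+ ½ ℚ.* ε
  lem : ∀ p ε → ℚ.- p ℚ.+ (p ℚ.+ ½ ℚ.* ε ℚ.+ (p ℚ.+ ½ ℚ.* ε)) ≡ p ℚ.+ ε
  lem = solve 2 (λ p ε → :- p :+ (p :+ con ½ :* ε :+ (p :+ con ½ :* ε)) := p :+ ε) refl
    where open ℚSolver

0≤⇒absolute≈ : ∀ {x} → 0ℝ ≤ x → absolute x ≈ x
0≤⇒absolute≈ {x} 0≤x ε 0<ε =
  let N , p = ≤⇒≲ {0ℝ} {x} 0≤x (½ ℚ.* ε) (half 0<ε)
  in N , λ n N≤n → ∣-∣≤ {∣ seq x n ∣} {seq x n} {ε}
       (∣p∣≤p+ε (seq x n) {ε} 0<ε (p n N≤n))
       (ℚ.≤-trans (p≤∣p∣ (seq x n)) (p≤p+ε ∣ seq x n ∣ {ε} (ℚ.<⇒≤ 0<ε)))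

pointwise-≤ : ∀ {x y} → (∀ n → seq x n ℚ.≤ seq y n) → x ≤ y
pointwise-≤ {x} {y} x≤y = ≲⇒≤ {x} {y} λ ε 0<ε → 0 , λ n _ → ℚ.≤-trans (x≤y n) (p≤p+ε (seq y n) (ℚ.<⇒≤ 0<ε))

square-nonNeg : ∀ p → 0ℚ ℚ.≤ p ℚ.* p
square-nonNeg p with ℚ.∣p∣≡p∨∣p∣≡-p p
... | inj₁ eq = subst (λ z → 0ℚ ℚ.≤ z ℚ.* z) eq (0≤* (ℚ.0≤∣p∣ p) (ℚ.0≤∣p∣ p))
... | inj₂ eq = subst (0ℚ ℚ.≤_) (trans (cong₂ ℚ._*_ eq eq) (lem p)) (0≤* (ℚ.0≤∣p∣ p) (ℚ.0≤∣p∣ p))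
  where
  lem : ∀ p → ℚ.- p ℚ.* ℚ.- p ≡ p ℚ.* p
  lem = solve 1 (λ p → :- p :* :- p := p :* p) refl
    where open ℚSolver

-- The terms of a nonnegative real may be negative. Absolute values are equal to the factors as
-- reals, and their product is nonnegative term by term.
0≤*ℝ : ∀ {x y} → 0ℝ ≤ x → 0ℝ ≤ y → 0ℝ ≤ x * y
0≤*ℝ {x} {y} 0≤x 0≤y = ≲⇒≤ {0ℝ} {x * y} (≲-trans {0ℝ} {absolute x * absolute y} {x * y}
  (≤⇒≲ {0ℝ} {absolute x * absolute y} (pointwise-≤ {0ℝ} {absolute x * absolute y}
    λ n → 0≤* (ℚ.0≤∣p∣ (seq x n)) (ℚ.0≤∣p∣ (seq y n))))
  (≈⇒≲ {absolute x * absolute y} {x * y} (*-cong {absolute x} {x} {absolute y} {y}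
    (0≤⇒absolute≈ {x} 0≤x) (0≤⇒absolute≈ {y} 0≤y))))

square-reflects-≤ : ∀ {p q} → 0ℚ ℚ.≤ q → p ℚ.* p ℚ.≤ q ℚ.* q → p ℚ.≤ q
square-reflects-≤ {p} {q} 0≤q p²≤q² = ℚ.≮⇒≥ λ q<p → ℚ.<-irrefl refl (ℚ.<-≤-trans
  (ℚ.≤-<-trans (ℚ.*-monoʳ-≤-nonNeg q {{ℚ.nonNegative 0≤q}} (ℚ.<⇒≤ q<p))
    (ℚ.*-monoʳ-<-pos p {{ℚ.positive (ℚ.≤-<-trans 0≤q q<p)}} q<p)) p²≤q²)

square≤⇒∣∣≤ : ∀ p {ε} → 0ℚ ℚ.≤ ε → p ℚ.* p ℚ.≤ ε ℚ.* ε → ∣ p ∣ ℚ.≤ ε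
square≤⇒∣∣≤ p {ε} 0≤ε p²≤ε² = square-reflects-≤ {∣ p ∣} {ε} 0≤ε (ℚ.≤-trans (ℚ.≤-reflexive
  (trans (sym (ℚ.∣p*q∣≡∣p∣*∣q∣ p p)) (ℚ.0≤p⇒∣p∣≡p (square-nonNeg p)))) p²≤ε²)

square≤0⇒≈0 : ∀ {x} → x * x ≤ 0ℝ → x ≈ 0ℝ
square≤0⇒≈0 {x} x²≤0 ε 0<ε =
  let N , p = ≤⇒≲ {x * x} {0ℝ} x²≤0 (ε ℚ.* ε) (0<* 0<ε 0<ε)
  in N , λ n N≤n → subst (λ z → ∣ z ∣ ℚ.≤ ε) (sym (ℚ.+-identityʳ (seq x n)))
       (square≤⇒∣∣≤ (seq x n) {ε} (ℚ.<⇒≤ 0<ε)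
         (ℚ.≤-trans (p n N≤n) (ℚ.≤-reflexive (ℚ.+-identityˡ (ε ℚ.* ε)))))

0<*ℝ : ∀ {x y} → 0ℝ < x → 0ℝ < y → 0ℝ < x * y
0<*ℝ (ε , 0<ε , N , p) (δ , 0<δ , M , q) = ε ℚ.* δ , 0<* 0<ε 0<δ , N ℕ.⊔ M , λ n N≤n →
  let p′ = ℚ.≤-trans (ℚ.≤-reflexive (sym (ℚ.+-identityˡ ε))) (p n (proj₁ (⊔-bounds N M N≤n)))
      q′ = ℚ.≤-trans (ℚ.≤-reflexive (sym (ℚ.+-identityˡ δ))) (q n (proj₂ (⊔-bounds N M N≤n)))
  in ℚ.≤-trans (ℚ.≤-reflexive (ℚ.+-identityˡ (ε ℚ.* δ)))
       (*-mono-≤ (ℚ.<⇒≤ 0<δ) (ℚ.≤-trans (ℚ.<⇒≤ 0<ε) p′) p′ q′)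

ℝ-algebra : OrderedℚAlgebra
ℝ-algebra = record
  { ring = ℝ-ring
  ; coefficients = record
    { ⟦_⟧    = fromℚ
    ; +-homo = λ p q → pointwise {fromℚ (p ℚ.+ q)} {fromℚ p + fromℚ q} λ _ → refl
    ; *-homo = λ p q → pointwise {fromℚ (p ℚ.* q)} {fromℚ p * fromℚ q} λ _ → refl
    ; -‿homo = λ p → pointwise {fromℚ (ℚ.- p)} { - fromℚ p} λ _ → refl
    ; 0-homo = ≈-refl {0ℝ}
    ; 1-homo = ≈-refl {1ℝ} }
  ; _≤_ = _≤_
  ; _<_ = _<_
  ; ≤-reflexive = λ {x} {y} x≈y → ≲⇒≤ {x} {y} (≈⇒≲ {x} {y} x≈y)
  ; ≤-trans = λ {x} {y} {z} x≤y y≤z →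
      ≲⇒≤ {x} {z} (≲-trans {x} {y} {z} (≤⇒≲ {x} {y} x≤y) (≤⇒≲ {y} {z} y≤z))
  ; ≤-antisym = λ {x} {y} x≤y y≤x → ≲-antisym {x} {y} (≤⇒≲ {x} {y} x≤y) (≤⇒≲ {y} {x} y≤x)
  ; +-mono-≤ = λ {x} {y} {z} {w} x≤y z≤w → ≲⇒≤ {x + z} {y + w}
      (+-mono-≲ {x} {y} {z} {w} (≤⇒≲ {x} {y} x≤y) (≤⇒≲ {z} {w} z≤w))
  ; 0≤x*y = λ {x} {y} → 0≤*ℝ {x} {y}
  ; 0<x*y = λ {x} {y} → 0<*ℝ {x} {y}
  ; ≮⇒≥ = λ y≮x → y≮x
  ; ≤⇒≯ = λ x≤y → x≤y
  ; 0≤x² = λ x → pointwise-≤ {0ℝ} {x * x} λ n → square-nonNeg (seq x n)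
  ; x²≤0⇒x≈0 = λ {x} → square≤0⇒≈0 {x}
  ; ι-mono-≤ = λ {p} {q} p≤q → pointwise-≤ {fromℚ p} {fromℚ q} λ _ → p≤q
  ; 0<1 = 1ℚ , ℚ.positive⁻¹ 1ℚ , 0 , λ _ _ → ℚ.≤-refl
  }

module R = OrderedℚAlgebra ℝ-algebra
module I = Inequalities ℝ-algebra

-- The rounding error in the terms of `√`: the nth term is rounded down to a multiple of 1/(n+1),
-- and one more unit makes its square an upper bound.
harmonic : ℝ
harmonic = mkℝ (λ n → ℤ.+ 1 ℚ./ suc n) λ ε 0<ε → let N , p = archimedean {ε} 0<ε in
  N , λ m n N≤m N≤n → ∣-∣≤ {ℤ.+ 1 ℚ./ suc m} {ℤ.+ 1 ℚ./ suc n} {ε} (below (p m N≤m) (/-nonNeg 1 n)) (below (p n N≤n) (/-nonNeg 1 m))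
  where
  below : ∀ {p q ε} → p ℚ.≤ ε → 0ℚ ℚ.≤ q → p ℚ.≤ q ℚ.+ ε
  below {p} {q} {ε} p≤ε 0≤q = ℚ.≤-trans p≤ε (ℚ.≤-trans (p≤p+ε ε {q} 0≤q) (ℚ.≤-reflexive (ℚ.+-comm ε q)))

harmonic≈0 : harmonic ≈ 0ℝ
harmonic≈0 ε 0<ε = let N , p = archimedean {ε} 0<ε in
  N , λ n N≤n → subst (ℚ._≤ ε)
    (sym (trans (cong ∣_∣ (ℚ.+-identityʳ (ℤ.+ 1 ℚ./ suc n))) (ℚ.0≤p⇒∣p∣≡p (/-nonNeg 1 n)))) (p n N≤n)

√-square : ∀ x → √ x * √ x ≈ absolute x
√-square x = R.≤-antisym {√ x * √ x} {absolute x}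
  (pointwise-≤ {√ x * √ x} {absolute x} λ n → √ℚ-lower (seq x n) n)
  (R.≤-trans {absolute x} {(√ x + harmonic) * (√ x + harmonic)} {√ x * √ x}
    (pointwise-≤ {absolute x} {(√ x + harmonic) * (√ x + harmonic)} λ n →
      subst (λ t → ∣ seq x n ∣ ℚ.≤ t ℚ.* t) (suc-/ (√-num (seq x n) (suc n)) n) (√ℚ-upper (seq x n) n))
    (R.≤-reflexive {(√ x + harmonic) * (√ x + harmonic)} {√ x * √ x}
      (*-cong {√ x + harmonic} {√ x} {√ x + harmonic} {√ x} √x+h≈ √x+h≈)))
  where
  √x+h≈ : √ x + harmonic ≈ √ x
  √x+h≈ = ≈-trans {√ x + harmonic} {√ x + 0ℝ} {√ x}
    (+-cong {√ x} {√ x} {harmonic} {0ℝ} (≈-refl {√ x}) harmonic≈0) (R.+-identityʳ (√ x))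

0≤√ : ∀ x → 0ℝ ≤ √ x
0≤√ x = pointwise-≤ {0ℝ} {√ x} λ n → /-nonNeg (√-num (seq x n) (suc n)) n

-- The length of the pieces, and rational approximation from above

natℚ : ℕ → ℚ
natℚ n = ℤ.+ n ℚ./ 1

natℚ-pos : ∀ n → 0ℚ ℚ.< natℚ (suc n)
natℚ-pos n = ℚ.positive⁻¹ (natℚ (suc n)) {{ℚ.normalize-pos (suc n) 1}}

1≤n*1/n : ∀ n → 1ℚ ℚ.≤ natℚ (suc n) ℚ.* (ℤ.+ 1 ℚ./ suc n)
1≤n*1/n n = ℚ.toℚᵘ-cancel-≤ (ℚᵘ.≤-trans (ℚᵘ.*≤* (ℤ.≤-reflexive eq))
  (ℚᵘ.≤-reflexive (ℚᵘ.≃-sym (ℚᵘ.≃-trans (ℚ.toℚᵘ-homo-* (natℚ (suc n)) (ℤ.+ 1 ℚ./ suc n))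
    (ℚᵘ.*-cong (ℚ.toℚᵘ-fromℚᵘ (ℚᵘ.mkℚᵘ (ℤ.+ suc n) 0)) (ℚ.toℚᵘ-fromℚᵘ (ℚᵘ.mkℚᵘ (ℤ.+ 1) n)))))))
  where
  eq : ℤ.+ 1 ℤ.* ℤ.+ (1 ℕ.* suc n) ≡ ℤ.+ suc n ℤ.* ℤ.+ 1 ℤ.* ℤ.+ 1
  eq = trans (ℤ.*-identityˡ _) (trans (cong ℤ.+_ (ℕ.*-identityˡ (suc n)))
    (sym (trans (ℤ.*-identityʳ _) (ℤ.*-identityʳ (ℤ.+ suc n)))))

-- Here `suc L` is the least integer not below 1/q, found by descending from an Archimedean bound.
-- The assumption q < 1 rules out `suc L` = 1, so `L` is positive and with it κ.
reciprocalFloor : ∀ q → 0ℚ ℚ.< q → q ℚ.< 1ℚ →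
  ∃ λ L → 0ℚ ℚ.< natℚ L × natℚ L ℚ.* q ℚ.< 1ℚ × 1ℚ ℚ.≤ natℚ (suc L) ℚ.* q
reciprocalFloor q 0<q q<1 = descend (proj₁ (archimedean 0<q))
  (ℚ.≤-trans (1≤n*1/n N) (ℚ.*-monoˡ-≤-nonNeg (natℚ (suc N)) {{ℚ.nonNegative (ℚ.<⇒≤ (natℚ-pos N))}}
    (proj₂ (archimedean 0<q) N ℕ.≤-refl)))
  where
  N = proj₁ (archimedean 0<q)
  descend : ∀ n → 1ℚ ℚ.≤ natℚ (suc n) ℚ.* q →
            ∃ λ L → 0ℚ ℚ.< natℚ L × natℚ L ℚ.* q ℚ.< 1ℚ × 1ℚ ℚ.≤ natℚ (suc L) ℚ.* q
  descend zero    1≤ = contradiction (ℚ.≤-<-trans (ℚ.≤-trans 1≤ (ℚ.≤-reflexive (ℚ.*-identityˡ q))) q<1) (ℚ.<-irrefl refl)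
  descend (suc n) 1≤ with 1ℚ ℚ.≤? natℚ (suc n) ℚ.* q
  ... | yes 1≤′ = descend n 1≤′
  ... | no  1≰  = suc n , natℚ-pos n , ℚ.≰⇒> 1≰ , 1≤

-- The subtracted term factors as (l q)(m q), where l q < 1 and m q = l q + q < 2.
gap-pos : ∀ l m q → 0ℚ ℚ.< l → m ≡ l ℚ.+ 1ℚ → 0ℚ ℚ.< q → q ℚ.< 1ℚ → l ℚ.* q ℚ.< 1ℚ →
  0ℚ ℚ.< l ℚ.* m ℚ.* (natℚ 2 ℚ.- l ℚ.* m ℚ.* (q ℚ.* q))
gap-pos l m q 0<l m≡ 0<q q<1 lq<1 = 0<* (0<* 0<l 0<m)
  (subst (ℚ._< natℚ 2 ℚ.- l ℚ.* m ℚ.* (q ℚ.* q)) (ℚ.+-inverseʳ (l ℚ.* m ℚ.* (q ℚ.* q)))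
    (ℚ.+-monoˡ-< (ℚ.- (l ℚ.* m ℚ.* (q ℚ.* q))) lmqq<2))
  where
  0<m : 0ℚ ℚ.< m
  0<m = subst (0ℚ ℚ.<_) (sym m≡) (ℚ.+-mono-< 0<l (ℚ.positive⁻¹ 1ℚ))
  mq<2 : m ℚ.* q ℚ.< natℚ 2
  mq<2 = subst (ℚ._< natℚ 2) (sym (trans (cong (ℚ._* q) m≡)
    (trans (ℚ.*-distribʳ-+ q l 1ℚ) (cong (l ℚ.* q ℚ.+_) (ℚ.*-identityˡ q))))) (ℚ.+-mono-< lq<1 q<1)
  lem : ∀ l m q → l ℚ.* m ℚ.* (q ℚ.* q) ≡ l ℚ.* q ℚ.* (m ℚ.* q)
  lem = solve 3 (λ l m q → l :* m :* (q :* q) := l :* q :* (m :* q)) refl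
    where open ℚSolver
  lmqq<2 : l ℚ.* m ℚ.* (q ℚ.* q) ℚ.< natℚ 2
  lmqq<2 = subst (ℚ._< natℚ 2) (sym (lem l m q)) (ℚ.<-trans
    (subst (l ℚ.* q ℚ.* (m ℚ.* q) ℚ.<_) (ℚ.*-identityˡ (m ℚ.* q))
      (ℚ.*-monoˡ-<-pos (m ℚ.* q) {{ℚ.positive (0<* 0<m 0<q)}} lq<1)) mq<2)

rationalAbove : ∀ r {δ} → 0ℚ ℚ.< δ → r < 1ℝ →
  ∃ λ q → r < fromℚ q × q ℚ.< 1ℚ × fromℚ q ≤ r + fromℚ δ
rationalAbove r {δ} 0<δ (ε , 0<ε , M , r+ε≤1) = q , (η , 0<η , N , λ n N≤n → r+η≤q n N≤n) , q<1
  , ≲⇒≤ {fromℚ q} {r + fromℚ δ} λ ε′ 0<ε′ → N , λ n N≤n →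
      ℚ.≤-trans (ℚ.<⇒≤ (q<r+μ n N≤n)) (ℚ.≤-trans (ℚ.+-monoʳ-≤ (seq r n) (ℚ.p⊓q≤p δ ε))
        (p≤p+ε (seq r n ℚ.+ δ) {ε′} (ℚ.<⇒≤ 0<ε′)))
  where
  μ = δ ℚ.⊓ ε
  0<μ : 0ℚ ℚ.< μ
  0<μ with ℚ.⊓-sel δ ε
  ... | inj₁ eq = subst (0ℚ ℚ.<_) (sym eq) 0<δ
  ... | inj₂ eq = subst (0ℚ ℚ.<_) (sym eq) 0<ε
  -- With `q` two steps η above the Nth term, and all later terms within η of that term, `q` lies at
  -- least η and at most 3η above them, hence less than μ = 4η.
  η = ½ ℚ.* (½ ℚ.* μ)
  0<η : 0ℚ ℚ.< η
  0<η = half (half 0<μ)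
  N = proj₁ (cauchy r η 0<η)
  close : ∀ m n → N ℕ.≤ m → N ℕ.≤ n → seq r m ℚ.≤ seq r n ℚ.+ η
  close m n N≤m N≤n = ∣-∣≤⇒≤+ (proj₂ (cauchy r η 0<η) m n N≤m N≤n)
  q = seq r N ℚ.+ (η ℚ.+ η)
  r+η≤q : ∀ n → N ℕ.≤ n → seq r n ℚ.+ η ℚ.≤ q
  r+η≤q n N≤n = ℚ.≤-trans (ℚ.+-monoˡ-≤ η (close n N N≤n ℕ.≤-refl)) (ℚ.≤-reflexive (ℚ.+-assoc (seq r N) η η))
  four : ∀ r μ → let η = ½ ℚ.* (½ ℚ.* μ) in r ℚ.+ η ℚ.+ (η ℚ.+ η) ℚ.+ η ≡ r ℚ.+ μ
  four = solve 2 (λ r μ → let η = con ½ :* (con ½ :* μ) in r :+ η :+ (η :+ η) :+ η := r :+ μ) refl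
    where open ℚSolver
  q<r+μ : ∀ n → N ℕ.≤ n → q ℚ.< seq r n ℚ.+ μ
  q<r+μ n N≤n = ℚ.≤-<-trans (ℚ.+-monoˡ-≤ (η ℚ.+ η) (close N n ℕ.≤-refl N≤n))
    (ℚ.<-≤-trans (p<p+ε (seq r n ℚ.+ η ℚ.+ (η ℚ.+ η)) 0<η) (ℚ.≤-reflexive (four (seq r n) μ)))
  q<1 : q ℚ.< 1ℚ
  q<1 = ℚ.<-≤-trans (q<r+μ n (ℕ.m≤m⊔n N M)) (ℚ.≤-trans (ℚ.+-monoʳ-≤ (seq r n) (ℚ.p⊓q≤q δ ε)) (r+ε≤1 n (ℕ.m≤n⊔m N M)))
    where n = N ℕ.⊔ M

-- Reduces the bound to rational slopes: the search for the piece length decides inequalities in `q`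
-- and needs `q` positive, whereas `r` is a real number that may be 0.
≤-limit : ∀ {κ} x r → 0ℚ ℚ.≤ κ → r < 1ℝ →
  (∀ q → r < fromℚ q → q ℚ.< 1ℚ → x ≤ fromℚ κ * fromℚ q) → x ≤ fromℚ κ * r
≤-limit {κ} x r 0≤κ r<1 x≤ (ε , 0<ε , N , κr+ε≤x) =
  let 0<κ+1 = ℚ.+-mono-≤-< 0≤κ (ℚ.positive⁻¹ 1ℚ)
      -- Division by κ + 1, since κ may be 0.
      δ , 0<δ , κδ≡ = fraction {½ ℚ.* ε} {κ ℚ.+ 1ℚ} (half 0<ε) 0<κ+1
      q , r<q , q<1 , q≤r+δ = rationalAbove r {δ} 0<δ r<1
      κδ≤ : κ ℚ.* δ ℚ.≤ ½ ℚ.* ε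
      κδ≤ = ℚ.≤-trans (ℚ.*-monoʳ-≤-nonNeg δ {{ℚ.nonNegative (ℚ.<⇒≤ 0<δ)}} (p≤p+ε κ {1ℚ} (ℚ.<⇒≤ (ℚ.positive⁻¹ 1ℚ))))
              (ℚ.≤-reflexive κδ≡)
  in R.≤-trans {x} {fromℚ κ * fromℚ q} {fromℚ κ * (r + fromℚ δ)} (x≤ q r<q q<1)
       (I.*-monoʳ-≤ {fromℚ κ} {fromℚ q} {r + fromℚ δ} (pointwise-≤ {0ℝ} {fromℚ κ} λ _ → 0≤κ) q≤r+δ)
       (½ ℚ.* ε , half 0<ε , N , λ n N≤n → ℚ.≤-trans (ℚ.+-monoˡ-≤ (½ ℚ.* ε) (ℚ.≤-reflexive (ℚ.*-distribˡ-+ κ (seq r n) δ)))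
         (ℚ.≤-trans (ℚ.+-monoˡ-≤ (½ ℚ.* ε) (ℚ.+-monoʳ-≤ (κ ℚ.* seq r n) κδ≤))
           (ℚ.≤-trans (ℚ.≤-reflexive (+½+½ (κ ℚ.* seq r n) ε)) (κr+ε≤x n N≤n))))

-- Spectral density

≤-foldr-⊔ : ∀ {n} (f : Fin n → ℕ) i → f i ℕ.≤ foldr ℕ._⊔_ 0 f
≤-foldr-⊔ {suc n} f zero    = ℕ.m≤m⊔n (f zero) _
≤-foldr-⊔ {suc n} f (suc i) = ℕ.≤-trans (≤-foldr-⊔ (λ j → f (suc j)) i) (ℕ.m≤n⊔m (f zero) _)

module Main (X : Graph) where
  open Graph X
  module G = KernelAndRank ℝ-algebra X

  1≤deg : Fin #E → 1 ℕ.≤ deg X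
  1≤deg e = ℕ.≤-trans atEndpoint (≤-foldr-⊔ (degreeAt X) (v₀ e))
    where
    one  = length (filter (oneEndpoint? X (v₀ e)) (allFin #E))
    both = length (filter (bothEndpoints? X (v₀ e)) (allFin #E))
    atEndpoint : 1 ℕ.≤ degreeAt X (v₀ e)
    atEndpoint with v₁ e Fin.≟ v₀ e
    ... | yes loop = ℕ.≤-trans (List.filter-some (bothEndpoints? X (v₀ e)) (lose (∈-allFin e) (refl , loop)))
          (ℕ.≤-trans (ℕ.m≤m+n both _) (ℕ.m≤n+m (2 ℕ.* both) one))
    ... | no noLoop = ℕ.≤-trans (List.filter-some (oneEndpoint? X (v₀ e)) (lose (∈-allFin e) (inj₁ (refl , noLoop))))
          (ℕ.m≤m+n one _)

  #E≤#E*deg : 2 ℕ.* #E ℕ.≤ 2 ℕ.* #E ℕ.* deg X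
  #E≤#E*deg = subst (ℕ._≤ 2 ℕ.* #E ℕ.* deg X) (ℕ.*-identityʳ (2 ℕ.* #E)) (bound #E 1≤deg)
    where
    bound : ∀ n → (Fin n → 1 ℕ.≤ deg X) → 2 ℕ.* n ℕ.* 1 ℕ.≤ 2 ℕ.* n ℕ.* deg X
    -- A graph without edges has degree 0; both sides are then 0.
    bound zero    _     = ℕ.z≤n
    bound (suc n) 1≤deg = ℕ.*-monoʳ-≤ (2 ℕ.* suc n) (1≤deg zero)

  ‖‖²≈ : ∀ {n} (v : 𝔼 n) → ‖ v ‖ * ‖ v ‖ ≈ ⟪ v , v ⟫
  ‖‖²≈ v = ≈-trans {‖ v ‖ * ‖ v ‖} {absolute ⟪ v , v ⟫} {⟪ v , v ⟫} (√-square ⟪ v , v ⟫)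
    (0≤⇒absolute≈ {⟪ v , v ⟫} (nonNeg v))
    where
    nonNeg : ∀ {n} (v : 𝔼 n) → 0ℝ ≤ ⟪ v , v ⟫
    nonNeg {zero}  v = R.≤-reflexive {0ℝ} {0ℝ} (≈-refl {0ℝ})
    nonNeg {suc n} v = R.+-mono-≤ {0ℝ} {v zero * v zero} {0ℝ} {⟪ (λ i → v (suc i)) , (λ i → v (suc i)) ⟫}
      (R.0≤x² (v zero)) (nonNeg λ i → v (suc i))

  cycles : Subspace #E
  cycles = record
    { Mem    = G.Span G.cycleVector
    ; resp-≋ = λ {u} {v} u≋v → G.span-resp G.cycleVector {u} {v} u≋v
    ; 0∈     = G.span-0 G.cycleVector
    ; +∈     = λ {u} {v} → G.span-+ G.cycleVector {u} {v}
    ; *∈     = λ c {v} → G.span-* G.cycleVector c {v}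
    }

  -- This supplies the lower bound `length outside` for the spectral density at 0. The norm vanishes
  -- because its square, a sum of squares of zeros, does.
  cycles-bounded : BoundedDimension (c₁ X) 0ℝ (length G.outside)
  cycles-bounded = cycles
    , record
      { basis       = G.cycleVector
      ; basis∈      = G.span-generator G.cycleVector
      ; independent = G.cycleVectors-independent
      ; spanning    = λ v v∈ → v∈ }
    , λ v (c , v≋) → R.≤-reflexive {‖ c₁ X v ‖} {0ℝ * ‖ v ‖}
        (≈-trans {‖ c₁ X v ‖} {0ℝ} {0ℝ * ‖ v ‖}
          (R.x²≤0⇒x≈0 {‖ c₁ X v ‖} (R.≤-reflexive {‖ c₁ X v ‖ * ‖ c₁ X v ‖} {0ℝ}
            (≈-trans {‖ c₁ X v ‖ * ‖ c₁ X v ‖} {⟪ c₁ X v , c₁ X v ⟫} {0ℝ} (‖‖²≈ (c₁ X v))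
              (G.sum-zero {#V} {λ w → c₁ X v w * c₁ X v w} λ w →
                ≈-trans {c₁ X v w * c₁ X v w} {0ℝ * c₁ X v w} {0ℝ}
                  (R.*-congʳ {c₁ X v w} {c₁ X v w} {0ℝ} (G.boundary-cycles c v v≋ w)) (R.zeroˡ (c₁ X v w))))))
          (≈-sym {0ℝ * ‖ v ‖} {0ℝ} (R.zeroˡ ‖ v ‖)))

  linearCombination∈ : ∀ {n} (V : Subspace n) {k} c (b : Fin k → 𝔼 n) →
    (∀ j → Subspace.Mem V (b j)) → Subspace.Mem V (linearCombination c b)
  linearCombination∈ V {zero}  c b b∈ = Subspace.0∈ V
  linearCombination∈ V {suc k} c b b∈ = Subspace.+∈ V (Subspace.*∈ V (c zero) (b∈ zero))
    (linearCombination∈ V (λ j → c (suc j)) (λ j → b (suc j)) (λ j → b∈ (suc j)))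

  -- The rank bound speaks of squared norms, so ‖c₁ a‖ ≤ r‖a‖ is first weakened to the slope `q` and
  -- then squared, both sides being nonnegative.
  dimension-≤ : ∀ L q r → r ≤ fromℚ q →
    0ℝ < fromℕ L * fromℕ (suc L) * (fromℕ 2 - fromℕ L * fromℕ (suc L) * (fromℚ q * fromℚ q)) →
    ∀ k → BoundedDimension (c₁ X) r k → k ℕ.≤ length G.outside ℕ.+ length (G.pieces L)
  dimension-≤ L q r r≤q gap k (V , dim , bounded) =
    G.rank-≤ L (fromℚ q * fromℚ q) gap basis independent λ c →
      let a = linearCombination c basis
          s = ‖ c₁ X a ‖
          t = ‖ a ‖
      in R.≤-trans {⟪ c₁ X a , c₁ X a ⟫} {s * s} {fromℚ q * fromℚ q * ⟪ a , a ⟫}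
           (R.≤-reflexive {⟪ c₁ X a , c₁ X a ⟫} {s * s} (≈-sym {s * s} {⟪ c₁ X a , c₁ X a ⟫} (‖‖²≈ (c₁ X a))))
           (R.≤-trans {s * s} {fromℚ q * fromℚ q * (t * t)} {fromℚ q * fromℚ q * ⟪ a , a ⟫}
             (G.square-≤ {r} {fromℚ q} {s} {t} (0≤√ ⟪ c₁ X a , c₁ X a ⟫) (0≤√ ⟪ a , a ⟫) r≤q (bounded a (linearCombination∈ V c basis basis∈)))
             (R.≤-reflexive {fromℚ q * fromℚ q * (t * t)} {fromℚ q * fromℚ q * ⟪ a , a ⟫}
               (R.*-congˡ {fromℚ q * fromℚ q} {t * t} {⟪ a , a ⟫} (‖‖²≈ a))))
    where open HasDimension dim

  slope : ℕ
  slope = 2 ℕ.* #E ℕ.* deg X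

  -- Neither supremum is computed: every admissible dimension at `r` is at most `m` + `P`, where `m`
  -- is admissible at 0 and `P` is at most the slope times `q`; the least upper bound property at
  -- `r` does the rest.
  spectral-≤ : ∀ r q (F₁[r] F₁[0] : ℝ) → 0ℝ ≤ r → r < fromℚ q → q ℚ.< 1ℚ →
    IsF₁ X r F₁[r] → IsF₁ X 0ℝ F₁[0] → F₁[r] - F₁[0] ≤ fromℕ slope * fromℚ q
  spectral-≤ r q F₁[r] F₁[0] 0≤r r<q q<1 sup[r] sup[0] =
    G.≤-+⇒-≤ {F₁[r]} {F₁[0]} {fromℕ slope * fromℚ q}
      (IsSupremum.least sup[r] (F₁[0] + fromℕ slope * fromℚ q) λ k bounded →
        R.≤-trans {fromℕ k} {fromℕ (m ℕ.+ P)} {F₁[0] + fromℕ slope * fromℚ q}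
          (G.nat-mono-≤ (dimension-≤ L q r r≤q gap k bounded))
          (R.≤-trans {fromℕ (m ℕ.+ P)} {fromℕ m + fromℕ P} {F₁[0] + fromℕ slope * fromℚ q}
            (R.≤-reflexive {fromℕ (m ℕ.+ P)} {fromℕ m + fromℕ P} (G.nat-+ m P))
            (R.+-mono-≤ {fromℕ m} {F₁[0]} {fromℕ P} {fromℕ slope * fromℚ q}
              (IsSupremum.upperBound sup[0] m cycles-bounded)
              (G.nat-≤-* P (suc L) slope {fromℚ q} (ℕ.≤-trans (G.length-pieces L) #E≤#E*deg)
                (pointwise-≤ {0ℝ} {fromℚ q} λ _ → ℚ.<⇒≤ 0<q)
                (pointwise-≤ {1ℝ} {fromℕ (suc L) * fromℚ q} λ _ → 1≤L+1q)))))
    where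
    r≤q : r ≤ fromℚ q
    r≤q = G.≮⇒≥ {fromℚ q} {r} λ q<r → contradictory r<q q<r
      where
      contradictory : r < fromℚ q → fromℚ q < r → _
      contradictory (ε , 0<ε , N , p) (δ , 0<δ , M , p′) = ℚ.<-irrefl refl
        (ℚ.<-≤-trans (p<p+ε (seq r n) 0<ε) (ℚ.≤-trans (p n (ℕ.m≤m⊔n N M))
          (ℚ.≤-trans (p≤p+ε q {δ} (ℚ.<⇒≤ 0<δ)) (p′ n (ℕ.m≤n⊔m N M)))))
        where n = N ℕ.⊔ M
    0<q : 0ℚ ℚ.< q
    0<q = ℚ.≰⇒> λ q≤0 → R.≤-trans {fromℚ q} {0ℝ} {r} (pointwise-≤ {fromℚ q} {0ℝ} λ _ → q≤0) 0≤r r<q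
    floor = reciprocalFloor q 0<q q<1
    L = proj₁ floor
    0<L : 0ℚ ℚ.< natℚ L
    0<L = proj₁ (proj₂ floor)
    1≤L+1q : 1ℚ ℚ.≤ natℚ (suc L) ℚ.* q
    1≤L+1q = proj₂ (proj₂ (proj₂ floor))
    gap : 0ℝ < fromℕ L * fromℕ (suc L) * (fromℕ 2 - fromℕ L * fromℕ (suc L) * (fromℚ q * fromℚ q))
    gap = let g = natℚ L ℚ.* natℚ (suc L) ℚ.* (natℚ 2 ℚ.- natℚ L ℚ.* natℚ (suc L) ℚ.* (q ℚ.* q)) in
      g , gap-pos (natℚ L) (natℚ (suc L)) q 0<L (suc-/ L 0) 0<q q<1 (proj₁ (proj₂ (proj₂ floor)))
      , 0 , λ _ _ → ℚ.≤-reflexive (ℚ.+-identityˡ g)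
    m = length G.outside
    P = length (G.pieces L)

theorem1p1 : (X : Graph) (r : ℝ) → 0ℝ ≤ r → r < 1ℝ →
    (F₁[r] F₁[0] : ℝ) → IsF₁ X r F₁[r] → IsF₁ X 0ℝ F₁[0] →
    F₁[r] - F₁[0] ≤ fromℕ 2 * fromℕ (Graph.#E X) * fromℕ (deg X) * r
theorem1p1 X r 0≤r r<1 F₁[r] F₁[0] sup[r] sup[0] =
  R.≤-trans {F₁[r] - F₁[0]} {fromℕ slope * r} {fromℕ 2 * fromℕ #E * fromℕ (deg X) * r}
    (≤-limit {natℚ slope} (F₁[r] - F₁[0]) r (/-nonNeg slope 0) r<1 λ q r<q q<1 →
      spectral-≤ r q F₁[r] F₁[0] 0≤r r<q q<1 sup[r] sup[0])
    (R.≤-reflexive {fromℕ slope * r} {fromℕ 2 * fromℕ #E * fromℕ (deg X) * r}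
      (R.*-congʳ {r} {fromℕ slope} {fromℕ 2 * fromℕ #E * fromℕ (deg X)}
        (≈-trans {fromℕ slope} {fromℕ (2 ℕ.* #E) * fromℕ (deg X)} {fromℕ 2 * fromℕ #E * fromℕ (deg X)}
          (G.nat-* (2 ℕ.* #E) (deg X))
          (R.*-congʳ {fromℕ (deg X)} {fromℕ (2 ℕ.* #E)} {fromℕ 2 * fromℕ #E} (G.nat-* 2 #E)))))
  where
  open Graph X
  open Main X
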